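{- For every $\ell$-type partial bipartite graph $\mathcal{P}=(C,D,S,T,f,g)$ with $C\in\mathbb{B}^{\ell\times m}$, $D\in\mathbb{B}^{\ell\times n}$, one can construct a Presburger formula $\Psi_{\mathcal{P}}(\bar X,\bar Y)$ such that for all $\bar M\in\mathbb{N}^m,\bar N\in\mathbb{N}^n$ big enough with respect to $C,D$: there exists a completion $G=(U\cup S,V\cup T,E_1,\dots,E_\ell)$ of $\mathcal{P}$ with witnessing partitions $U=U_1\cup\dots\cup U_m$, $V=V_1\cup\dots\cup V_n$ satisfying $\bar M=(|U_1|,\dots,|U_m|)$ and $\bar N=(|V_1|,\dots,|V_n|)$ if and only if $\Psi_{\mathcal{P}}(\bar M,\bar N)$ holds.
   Context: A Presburger formula is a first-order formula with $+,\le,0,1$ over $\mathbb{N}$. $\mathbb{B}=\mathbb{N}\cup\{{\ge}d\mid d\in\mathbb{N}\}$, "$x={\ge}d$" meaning $x\ge d$; $\lfloor{\ge}d\rfloor=d$, $\lfloor d\rfloor=d$. An $\ell$-type partial bipartite graph is $\mathcal{P}=(C,D,S,T,f,g)$ with $C\in\mathbb{B}^{\ell\times m}$, $D\in\mathbb{B}^{\ell\times n}$, finite (possibly empty) vertex sets $S,T$, and functions $f:S\times\{E_1,\dots,E_\ell\}\to\mathbb{B}$, $g:T\times\{E_1,\dots,E_\ell\}\to\mathbb{B}$. A completion of $\mathcal{P}$ is a bipartite graph $G=(U\cup S,V\cup T,E_1,\dots,E_\ell)$ (pairwise disjoint $E_i\subseteq(U\cup S)\times(V\cup T)$, $\deg_{E_i}$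 = number of incident $E_i$-edges) together with partitions $U=U_1\cup\dots\cup U_m$, $V=V_1\cup\dots\cup V_n$ such that $\deg_{E_i}(u)=C_{i,j}$ for $u\in U_j$, $\deg_{E_i}(v)=D_{i,j}$ for $v\in V_j$, $\deg_{E_i}(s)=f(s,E_i)$ for $s\in S$, $\deg_{E_i}(t)=g(t,E_i)$ for $t\in T$. With rows $\bar c_i,\bar d_i$ of $C,D$, dot products taken after $\lfloor\cdot\rfloor$, $C\cdot\bar1=\sum\lfloor C_{i,j}\rfloor$, and $\chi(\bar t)$ the 0/1-vector with $0$ exactly where $\lfloor t_i\rfloor=0$: $\bar M,\bar N$ are big enough w.r.t. $C,D$ if for all $i\le\ell$: (1) $\bar M\cdot\chi(\bar c_i)+\bar N\cdot\chi(\bar d_i)\ge2(C\cdot\bar1)(D\cdot\bar1)+3$; (2) $\sum_{j:\,D_{i,j}\text{ of form }{\ge}k}N_j\ge\max_{j\le m}\lfloor C_{i,j}\rfloor$; (3) $\sum_{j:\,C_{i,j}\text{ of form }{\ge}k}M_j\ge\max_{j\le n}\lfloor D_{i,j}\rfloor$. -}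

module Defs where

open import Data.Nat using (ℕ; zero; suc; _+_; _*_; _≤_)
open import Data.Fin using (Fin)
open import Data.Bool using (Bool; true; false; if_then_else_; _∧_)
open import Data.Sum using (_⊎_; inj₁; inj₂)
open import Data.Product using (Σ; _×_; _,_; ∃)
open import Data.Empty using (⊥)
open import Relation.Binary.PropositionalEquality using (_≡_; _≢_)
open import Data.Vec.Functional using (Vector; _++_)

ΣF : ∀ {k} → (Fin k → ℕ) → ℕ
ΣF {zero}  f = 0
ΣF {suc k} f = f Fin.zero + ΣF (λ i → f (Fin.suc i))

countF : ∀ {k} → (Fin k → Bool) → ℕ
countF p = ΣF (λ i → if p i then 1 else 0)

data 𝔹 : Set where
  exactly : ℕ → 𝔹
  atLeast : ℕ → 𝔹

⌊_⌋ : 𝔹 → ℕ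
⌊ exactly d ⌋ = d
⌊ atLeast d ⌋ = d

_≐_ : ℕ → 𝔹 → Set
x ≐ exactly d = x ≡ d
x ≐ atLeast d = d ≤ x

isAtLeast : 𝔹 → Bool
isAtLeast (exactly _) = false
isAtLeast (atLeast _) = true

χ : 𝔹 → ℕ
χ b with ⌊ b ⌋
... | zero  = 0
... | suc _ = 1

-- ℓ-type partial bipartite graphs  P = (C, D, S, T, f, g)
-- S and T are finite sets, represented (up to renaming) as Fin s, Fin t.

record PartialBipartite (ℓ m n : ℕ) : Set where
  field
    C : Fin ℓ → Fin m → 𝔹
    D : Fin ℓ → Fin n → 𝔹
    s : ℕ
    t : ℕ
    f : Fin s → Fin ℓ → 𝔹
    g : Fin t → Fin ℓ → 𝔹

-- Completions.
-- Given M ∈ ℕ^m, N ∈ ℕ^n, the new vertices are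
--   U = U_1 ∪ … ∪ U_m  with  U_j = {j} × Fin (M j),  so |U_j| = M j,
--   V = V_1 ∪ … ∪ V_n  with  V_j = {j} × Fin (N j),  so |V_j| = N j,
-- and the two sides of the graph are U ⊎ S and V ⊎ T (disjoint unions).

Part : ∀ {m} → Vector ℕ m → Set
Part {m} M = Σ (Fin m) (λ j → Fin (M j))

LeftV : ∀ {m} → Vector ℕ m → ℕ → Set
LeftV M s = Part M ⊎ Fin s

RightV : ∀ {n} → Vector ℕ n → ℕ → Set
RightV N t = Part N ⊎ Fin t

countPart : ∀ {m} (M : Vector ℕ m) → (Part M → Bool) → ℕ
countPart M p = ΣF (λ j → countF (λ x → p (j , x)))

countSide : ∀ {m} (M : Vector ℕ m) (s : ℕ) → (Part M ⊎ Fin s → Bool) → ℕ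
countSide M s p = countPart M (λ x → p (inj₁ x)) + countF (λ x → p (inj₂ x))

record Completion {ℓ m n : ℕ} (P : PartialBipartite ℓ m n)
                  (M : Vector ℕ m) (N : Vector ℕ n) : Set where
  open PartialBipartite P
  field
    E : Fin ℓ → LeftV M s → RightV N t → Bool
    disjoint : ∀ (i i' : Fin ℓ) → i ≢ i' → ∀ x y →
               E i x y ≡ true → E i' x y ≡ true → ⊥
  degL : Fin ℓ → LeftV M s → ℕ
  degL i x = countSide N t (λ y → E i x y)
  degR : Fin ℓ → RightV N t → ℕ
  degR i y = countSide M s (λ x → E i x y)
  field
    degU : ∀ i j (u : Fin (M j)) → degL i (inj₁ (j , u)) ≐ C i j
    degV : ∀ i j (v : Fin (N j)) → degR i (inj₁ (j , v)) ≐ D i j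
    degS : ∀ i (x : Fin s) → degL i (inj₂ x) ≐ f x i
    degT : ∀ i (y : Fin t) → degR i (inj₂ y) ≐ g y i

sum⌊⌋ : ∀ {ℓ k} → (Fin ℓ → Fin k → 𝔹) → ℕ
sum⌊⌋ A = ΣF (λ i → ΣF (λ j → ⌊ A i j ⌋))

record BigEnough {ℓ m n : ℕ} (C : Fin ℓ → Fin m → 𝔹) (D : Fin ℓ → Fin n → 𝔹)
                 (M : Vector ℕ m) (N : Vector ℕ n) : Set where
  field
    cond1 : ∀ i → 2 * (sum⌊⌋ C * sum⌊⌋ D) + 3
                    ≤ ΣF (λ j → M j * χ (C i j)) + ΣF (λ j → N j * χ (D i j))
    cond2 : ∀ i (j' : Fin m) →
            ⌊ C i j' ⌋ ≤ ΣF (λ j → if isAtLeast (D i j) then N j else 0)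
    cond3 : ∀ i (j' : Fin n) →
            ⌊ D i j' ⌋ ≤ ΣF (λ j → if isAtLeast (C i j) then M j else 0)

data Term (k : ℕ) : Set where
  var  : Fin k → Term k
  zer  : Term k
  one  : Term k
  _⊕_  : Term k → Term k → Term k

data Formula (k : ℕ) : Set where
  _≤ₜ_  : Term k → Term k → Formula k
  _≡ₜ_  : Term k → Term k → Formula k
  ⊥ₚ    : Formula k
  ¬ₚ_   : Formula k → Formula k
  _∧ₚ_  : Formula k → Formula k → Formula k
  _∨ₚ_  : Formula k → Formula k → Formula k
  _⇒ₚ_  : Formula k → Formula k → Formula k
  ∃ₚ    : Formula (suc k) → Formula k   -- binds variable Fin.zero
  ∀ₚ    : Formula (suc k) → Formula k

evalT : ∀ {k} → Vector ℕ k → Term k → ℕ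
evalT ρ (var x) = ρ x
evalT ρ zer = 0
evalT ρ one = 1
evalT ρ (a ⊕ b) = evalT ρ a + evalT ρ b

extend : ∀ {k} → ℕ → Vector ℕ k → Vector ℕ (suc k)
extend a ρ Fin.zero = a
extend a ρ (Fin.suc x) = ρ x

⟦_⟧ : ∀ {k} → Formula k → Vector ℕ k → Set
⟦ a ≤ₜ b ⟧ ρ = evalT ρ a ≤ evalT ρ b
⟦ a ≡ₜ b ⟧ ρ = evalT ρ a ≡ evalT ρ b
⟦ ⊥ₚ ⟧ ρ = ⊥
⟦ ¬ₚ φ ⟧ ρ = ⟦ φ ⟧ ρ → ⊥
⟦ φ ∧ₚ ψ ⟧ ρ = ⟦ φ ⟧ ρ × ⟦ ψ ⟧ ρ
⟦ φ ∨ₚ ψ ⟧ ρ = ⟦ φ ⟧ ρ ⊎ ⟦ ψ ⟧ ρ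
⟦ φ ⇒ₚ ψ ⟧ ρ = ⟦ φ ⟧ ρ → ⟦ ψ ⟧ ρ
⟦ ∃ₚ φ ⟧ ρ = ∃ λ a → ⟦ φ ⟧ (extend a ρ)
⟦ ∀ₚ φ ⟧ ρ = ∀ a → ⟦ φ ⟧ (extend a ρ)

holds : ∀ {m n} → Formula (m + n) → Vector ℕ m → Vector ℕ n → Set
holds Ψ M N = ⟦ Ψ ⟧ (M ++ N)

{-# OPTIONS --safe #-}
module Submission where

-- Let d bound all ⌊demands⌋. An edge with surplus degree at both ends can be deleted. Set aside in
-- each class a reservoir of ℓ d vertices (or the whole class) and the few vertices tightly joined to
-- a reservoir of the other side: these form a core of bounded size. An edge outside the core with
-- surplus at one end can be redirected from that end to a reservoir vertex of the same class, so we
-- may assume that outside the core all degrees are at most d. Colours with only a few edges outside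
-- the core are killed by enlarging the core, so each colour has none or at least 3 ℓ d² + 1 of them.
--
-- Such a graph is described, up to the edges outside the core, by boundedly many states: the core
-- vertices, and for the others the colours of the edges to the core together with the residual
-- degrees. Conversely, numbers of vertices per class and state that satisfy the degree conditions and
-- balance the residual degrees come from a graph: the remaining edges are inserted one by one, and
-- when a pair x, y is blocked, some edge x′y′ of the same colour can be exchanged for xy′ and x′y,
-- since only 3 ℓ d² edges can obstruct this. All conditions on these numbers are linear, and there are
-- finitely many systems of states, so the existence of a completion is Presburger definable.

open import Defs
open import Data.Bool using (Bool; true; false; if_then_else_; _∧_; _∨_; not)
open import Data.Bool.Properties using () renaming (_≟_ to _≟ᵇ_)
open import Data.Empty using (⊥; ⊥-elim)
open import Data.Fin using (Fin; zero; suc; toℕ; fromℕ<; _↑ˡ_; _↑ʳ_; splitAt; join; combine; remQuot; funToFin; finToFun)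
open import Data.Fin.Properties using (_≟_; any?; suc-injective; splitAt-↑ˡ; splitAt-↑ʳ; splitAt⁻¹-↑ˡ; splitAt⁻¹-↑ʳ; ↑ˡ-injective; ↑ʳ-injective; join-splitAt; remQuot-combine; finToFun-funToFin; toℕ-fromℕ<; toℕ<n; toℕ-injective)
open import Data.Nat using (ℕ; zero; suc; _+_; _*_; _∸_; _^_; _≤_; _<_; z≤n; s≤s; _<?_)
open import Data.Nat.Properties hiding (_≟_; suc-injective)
open import Data.Nat.Solver using (module +-*-Solver)
open import Data.Product using (Σ; ∃; _×_; _,_; proj₁; proj₂)
open import Data.Sum using (_⊎_; inj₁; inj₂; [_,_]′)
open import Data.Vec.Functional using (Vector; _++_; _∷_)
open import Data.Vec.Functional.Properties using (lookup-++ˡ; lookup-++ʳ)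
open import Function using (_∘_; flip; id)
open import Function.Bundles using (_⇔_; mk⇔)
open import Relation.Binary.PropositionalEquality
open import Relation.Nullary using (¬_; Dec; yes; no; does; contradiction)
open import Relation.Nullary.Decidable using (_×-dec_; _⊎-dec_; ¬?; dec-true; dec-false)

private variable
  a b k l ℓ m n p q : ℕ

-- Finite sums

𝟙 : Bool → ℕ
𝟙 b = if b then 1 else 0

𝟙≤1 : ∀ b → 𝟙 b ≤ 1
𝟙≤1 true  = ≤-refl
𝟙≤1 false = z≤n

δ : Fin k → Fin k → ℕ
δ i j = 𝟙 (does (i ≟ j))

δ-refl : (i : Fin k) → δ i i ≡ 1
δ-refl i = cong 𝟙 (dec-true (i ≟ i) refl)

δ-≡ : {i j : Fin k} → i ≡ j → δ i j ≡ 1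
δ-≡ {i = i} refl = δ-refl i

δ-≢ : {i j : Fin k} → i ≢ j → δ i j ≡ 0
δ-≢ {i = i} {j} i≢j = cong 𝟙 (dec-false (i ≟ j) i≢j)

0<δ⇒≡ : {i j : Fin k} → 0 < δ i j → i ≡ j
0<δ⇒≡ {i = i} {j} 0<δ with i ≟ j
... | yes eq = eq

δ*δ-cases : (x y : Fin k) (i j : Fin l) →
            (x ≡ y × i ≡ j × δ x y * δ i j ≡ 1) ⊎ δ x y * δ i j ≡ 0
δ*δ-cases x y i j with x ≟ y | i ≟ j
... | yes x≡y | yes i≡j = inj₁ (x≡y , i≡j , refl)
... | yes _   | no _    = inj₂ refl
... | no _    | _       = inj₂ refl

ΣF-cong : {f g : Fin k → ℕ} → (∀ i → f i ≡ g i) → ΣF f ≡ ΣF g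
ΣF-cong {zero}  f≗g = refl
ΣF-cong {suc k} f≗g = cong₂ _+_ (f≗g zero) (ΣF-cong (f≗g ∘ suc))

ΣF-mono : {f g : Fin k → ℕ} → (∀ i → f i ≤ g i) → ΣF f ≤ ΣF g
ΣF-mono {zero}  f≤g = z≤n
ΣF-mono {suc k} f≤g = +-mono-≤ (f≤g zero) (ΣF-mono (f≤g ∘ suc))

ΣF-mono-< : {f g : Fin k → ℕ} → (∀ i → f i ≤ g i) → ∀ i → f i < g i → ΣF f < ΣF g
ΣF-mono-< f≤g zero    f<g = +-mono-<-≤ f<g (ΣF-mono (f≤g ∘ suc))
ΣF-mono-< f≤g (suc i) f<g = +-mono-≤-< (f≤g zero) (ΣF-mono-< (f≤g ∘ suc) i f<g)

ΣF-≤-antisym : {f g : Fin k → ℕ} → (∀ i → f i ≤ g i) → ΣF g ≤ ΣF f → ∀ i → f i ≡ g i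
ΣF-≤-antisym {f = f} {g} f≤g Σg≤Σf i with f i <? g i
... | yes f<g = contradiction (ΣF-mono-< f≤g i f<g) (≤⇒≯ Σg≤Σf)
... | no  f≮g = ≤-antisym (f≤g i) (≮⇒≥ f≮g)

ΣF-0 : ∀ k → ΣF {k} (λ _ → 0) ≡ 0
ΣF-0 zero    = refl
ΣF-0 (suc k) = ΣF-0 k

ΣF-zero : {f : Fin k → ℕ} → (∀ i → f i ≡ 0) → ΣF f ≡ 0
ΣF-zero {k} f≗0 = trans (ΣF-cong f≗0) (ΣF-0 k)

ΣF-const : ∀ k c → ΣF {k} (λ _ → c) ≡ k * c
ΣF-const zero    c = refl
ΣF-const (suc k) c = cong (c +_) (ΣF-const k c)

ΣF-≤-* : {f : Fin k → ℕ} {c : ℕ} → (∀ i → f i ≤ c) → ΣF f ≤ k * c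
ΣF-≤-* {k} {c = c} f≤c = ≤-trans (ΣF-mono f≤c) (≤-reflexive (ΣF-const k c))

ΣF-+ : (f g : Fin k → ℕ) → ΣF (λ i → f i + g i) ≡ ΣF f + ΣF g
ΣF-+ {zero}  f g = refl
ΣF-+ {suc k} f g rewrite ΣF-+ (f ∘ suc) (g ∘ suc) =
  solve 4 (λ x y z w → (x :+ y) :+ (z :+ w) := (x :+ z) :+ (y :+ w)) refl
    (f zero) (g zero) (ΣF (f ∘ suc)) (ΣF (g ∘ suc))
  where open +-*-Solver

ΣF-*ʳ : (f : Fin k → ℕ) (c : ℕ) → ΣF (λ i → f i * c) ≡ ΣF f * c
ΣF-*ʳ {zero}  f c = refl
ΣF-*ʳ {suc k} f c rewrite ΣF-*ʳ (f ∘ suc) c = sym (*-distribʳ-+ c (f zero) (ΣF (f ∘ suc)))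

ΣF-*ˡ : (c : ℕ) (f : Fin k → ℕ) → ΣF (λ i → c * f i) ≡ c * ΣF f
ΣF-*ˡ c f = trans (ΣF-cong (λ i → *-comm c (f i))) (trans (ΣF-*ʳ f c) (*-comm (ΣF f) c))

ΣF-swap : (f : Fin k → Fin l → ℕ) → ΣF (λ i → ΣF (f i)) ≡ ΣF (λ j → ΣF (λ i → f i j))
ΣF-swap {zero}  {l} f = sym (ΣF-0 l)
ΣF-swap {suc k} {l} f =
  trans (cong (ΣF (f zero) +_) (ΣF-swap (f ∘ suc)))
        (sym (ΣF-+ (f zero) (λ j → ΣF (λ i → f (suc i) j))))

term≤ΣF : (f : Fin k → ℕ) → ∀ i → f i ≤ ΣF f
term≤ΣF f zero    = m≤m+n _ _
term≤ΣF f (suc i) = ≤-trans (term≤ΣF (f ∘ suc) i) (m≤n+m _ _)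

-- Cross-added, because subtraction on ℕ truncates: both sides are the common part away from `i`
-- plus the values of `f` and `g` at `i`.
ΣF-except : {f g : Fin k → ℕ} (i : Fin k) → (∀ j → j ≢ i → f j ≡ g j) →
            ΣF f + g i ≡ ΣF g + f i
ΣF-except {f = f} {g} zero f≗g rewrite ΣF-cong {f = f ∘ suc} {g ∘ suc} (λ j → f≗g (suc j) λ ()) =
  solve 3 (λ x y z → (x :+ y) :+ z := (z :+ y) :+ x) refl (f zero) (ΣF (g ∘ suc)) (g zero)
  where open +-*-Solver
ΣF-except {f = f} {g} (suc i) f≗g rewrite f≗g zero (λ ()) =
  trans (+-assoc (g zero) _ _)
        (trans (cong (g zero +_) (ΣF-except i (λ j j≢i → f≗g (suc j) (j≢i ∘ suc-injective))))
               (sym (+-assoc (g zero) _ _)))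

ΣF-δ : (i : Fin k) (f : Fin k → ℕ) → ΣF (λ j → δ j i * f j) ≡ f i
ΣF-δ {k} i f = begin
  ΣF (λ j → δ j i * f j)     ≡⟨ +-identityʳ _ ⟨
  ΣF (λ j → δ j i * f j) + 0 ≡⟨ ΣF-except {g = λ _ → 0} i (λ j j≢i → cong (_* f j) (δ-≢ j≢i)) ⟩
  ΣF {k} (λ _ → 0) + δ i i * f i ≡⟨ cong₂ _+_ (ΣF-0 k) (cong (_* f i) (δ-refl i)) ⟩
  1 * f i                    ≡⟨ *-identityˡ (f i) ⟩
  f i                        ∎
  where open ≡-Reasoning

δ-sym : (i j : Fin k) → δ i j ≡ δ j i
δ-sym i j with i ≟ j
... | yes i≡j = sym (δ-≡ (sym i≡j))
... | no  i≢j = sym (δ-≢ (i≢j ∘ sym))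

ΣF-δ′ : (i : Fin k) (f : Fin k → ℕ) → ΣF (λ j → δ i j * f j) ≡ f i
ΣF-δ′ i f = trans (ΣF-cong (λ j → cong (_* f j) (δ-sym i j))) (ΣF-δ i f)

ΣF-δ₁ : (i : Fin k) → ΣF (λ j → δ i j) ≡ 1
ΣF-δ₁ i = trans (ΣF-cong (λ j → sym (*-identityʳ (δ i j)))) (ΣF-δ′ i (λ _ → 1))

ΣF-<⇒∃ : (f g : Fin k → ℕ) → ΣF f < ΣF g → ∃ λ i → f i < g i
ΣF-<⇒∃ f g Σf<Σg with any? (λ i → f i <? g i)
... | yes found = found
... | no  none  = contradiction (ΣF-mono (λ i → ≮⇒≥ (λ lt → none (i , lt)))) (<⇒≱ Σf<Σg)

0<ΣF⇒∃ : (f : Fin k → ℕ) → 0 < ΣF f → ∃ λ i → 0 < f i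
0<ΣF⇒∃ {k} f 0<Σ = ΣF-<⇒∃ (λ _ → 0) f (subst (_< ΣF f) (sym (ΣF-0 k)) 0<Σ)

ΣF-split : ∀ a {b} (f : Fin (a + b) → ℕ) →
           ΣF f ≡ ΣF (λ i → f (i ↑ˡ b)) + ΣF (λ j → f (a ↑ʳ j))
ΣF-split zero    f = refl
ΣF-split (suc a) f = trans (cong (f zero +_) (ΣF-split a (f ∘ suc))) (sym (+-assoc (f zero) _ _))

-- Edge colourings

-- Colour zero means that the two vertices are not joined.
Colouring : ℕ → ℕ → ℕ → Set
Colouring a b ℓ = Fin a → Fin b → Fin (suc ℓ)

degree : Colouring a b ℓ → Fin a → Fin ℓ → ℕ
degree c x i = ΣF (λ y → δ (c x y) (suc i))

degree-cong : {c c′ : Colouring a b ℓ} → (∀ x y → c x y ≡ c′ x y) →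
              ∀ x i → degree c x i ≡ degree c′ x i
degree-cong c≗c′ x i = ΣF-cong (λ y → cong (λ e → δ e (suc i)) (c≗c′ x y))

set : Colouring a b ℓ → Fin a → Fin b → Fin (suc ℓ) → Colouring a b ℓ
set c x y e x′ y′ = if does (x′ ≟ x) ∧ does (y′ ≟ y) then e else c x′ y′

module _ (c : Colouring a b ℓ) (x : Fin a) (y : Fin b) (e : Fin (suc ℓ)) where

  set-here : set c x y e x y ≡ e
  set-here rewrite dec-true (x ≟ x) refl | dec-true (y ≟ y) refl = refl

  set-row : ∀ {x′} y′ → x′ ≢ x → set c x y e x′ y′ ≡ c x′ y′
  set-row {x′} y′ x′≢x rewrite dec-false (x′ ≟ x) x′≢x = refl

  set-column : ∀ x′ {y′} → y′ ≢ y → set c x y e x′ y′ ≡ c x′ y′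
  set-column x′ {y′} y′≢y rewrite dec-false (y′ ≟ y) y′≢y with x′ ≟ x
  ... | yes _ = refl
  ... | no  _ = refl

  set-cases : ∀ x′ y′ → (x′ ≡ x × y′ ≡ y × set c x y e x′ y′ ≡ e) ⊎ set c x y e x′ y′ ≡ c x′ y′
  set-cases x′ y′ with x′ ≟ x | y′ ≟ y
  ... | yes x′≡x | yes y′≡y = inj₁ (x′≡x , y′≡y , refl)
  ... | yes _    | no _     = inj₂ refl
  ... | no _     | _        = inj₂ refl

  set-flip : ∀ x′ y′ → set c x y e x′ y′ ≡ set (flip c) y x e y′ x′
  set-flip x′ y′ with x′ ≟ x | y′ ≟ y
  ... | yes _ | yes _ = refl
  ... | yes _ | no _  = refl
  ... | no _  | yes _ = refl
  ... | no _  | no _  = refl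

  -- Only the entry at `x`, `y` changes, so `ΣF-except` applies to the row of `x`. The old colour is
  -- added on one side and the new one on the other; either may be zero, which contributes nothing.
  degree-set : ∀ x′ i → degree (set c x y e) x′ i + δ x′ x * δ (c x y) (suc i)
                        ≡ degree c x′ i + δ x′ x * δ e (suc i)
  degree-set x′ i with x′ ≟ x
  ... | no x′≢x = refl
  ... | yes refl rewrite *-identityˡ (δ (c x y) (suc i)) | *-identityˡ (δ e (suc i)) =
    trans (ΣF-except {g = λ y′ → δ (c x y′) (suc i)} y
             (λ y′ y′≢y → cong (λ e → δ e (suc i)) (row y′ y′≢y)))
          (cong (λ e → degree c x i + δ e (suc i)) here)
    where
    row : ∀ y′ → y′ ≢ y → (if does (y′ ≟ y) then e else c x y′) ≡ c x y′
    row y′ y′≢y rewrite dec-false (y′ ≟ y) y′≢y = refl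
    here : (if does (y ≟ y) then e else c x y) ≡ e
    here rewrite dec-true (y ≟ y) refl = refl

degree-add : (c : Colouring a b ℓ) (x : Fin a) (y : Fin b) (i : Fin ℓ) → c x y ≡ zero →
             ∀ x′ j → degree (set c x y (suc i)) x′ j ≡ degree c x′ j + δ x′ x * δ i j
degree-add c x y i cxy x′ j = begin
  degree (set c x y (suc i)) x′ j
    ≡⟨ +-identityʳ _ ⟨
  degree (set c x y (suc i)) x′ j + 0
    ≡⟨ cong (degree (set c x y (suc i)) x′ j +_)
         (trans (cong (δ x′ x *_) (cong (λ e → δ e (suc j)) cxy)) (*-zeroʳ (δ x′ x))) ⟨
  degree (set c x y (suc i)) x′ j + δ x′ x * δ (c x y) (suc j)
    ≡⟨ degree-set c x y (suc i) x′ j ⟩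
  degree c x′ j + δ x′ x * δ i j ∎
  where open ≡-Reasoning

degree-remove : (c : Colouring a b ℓ) (x : Fin a) (y : Fin b) (i : Fin ℓ) → c x y ≡ suc i →
                ∀ x′ j → degree (set c x y zero) x′ j + δ x′ x * δ i j ≡ degree c x′ j
degree-remove c x y i cxy x′ j = begin
  degree (set c x y zero) x′ j + δ x′ x * δ i j
    ≡⟨ cong (λ e → degree (set c x y zero) x′ j + δ x′ x * δ e (suc j)) cxy ⟨
  degree (set c x y zero) x′ j + δ x′ x * δ (c x y) (suc j)
    ≡⟨ degree-set c x y zero x′ j ⟩
  degree c x′ j + δ x′ x * 0
    ≡⟨ cong (degree c x′ j +_) (*-zeroʳ (δ x′ x)) ⟩
  degree c x′ j + 0
    ≡⟨ +-identityʳ _ ⟩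
  degree c x′ j ∎
  where open ≡-Reasoning

degree-add′ : (c : Colouring a b ℓ) (x : Fin a) (y : Fin b) (i : Fin ℓ) → c x y ≡ zero →
              ∀ y′ j → degree (flip (set c x y (suc i))) y′ j ≡ degree (flip c) y′ j + δ y′ y * δ i j
degree-add′ c x y i cxy y′ j =
  trans (degree-cong (λ y″ x″ → set-flip c x y (suc i) x″ y″) y′ j)
        (degree-add (flip c) y x i cxy y′ j)

degree-remove′ : (c : Colouring a b ℓ) (x : Fin a) (y : Fin b) (i : Fin ℓ) → c x y ≡ suc i →
                 ∀ y′ j → degree (flip (set c x y zero)) y′ j + δ y′ y * δ i j ≡ degree (flip c) y′ j
degree-remove′ c x y i cxy y′ j =
  trans (cong (_+ δ y′ y * δ i j) (degree-cong (λ y″ x″ → set-flip c x y zero x″ y″) y′ j))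
        (degree-remove (flip c) y x i cxy y′ j)

handshake : (c : Colouring a b ℓ) (i : Fin ℓ) →
            ΣF (λ x → degree c x i) ≡ ΣF (λ y → degree (flip c) y i)
handshake c i = ΣF-swap (λ x y → δ (c x y) (suc i))

adj : Fin (suc ℓ) → ℕ
adj zero    = 0
adj (suc _) = 1

adj≡Σδ : (e : Fin (suc ℓ)) → adj e ≡ ΣF (λ i → δ e (suc i))
adj≡Σδ {ℓ} zero = sym (ΣF-0 ℓ)
adj≡Σδ (suc i)  = sym (ΣF-δ₁ i)

Σadj : (c : Colouring a b ℓ) (x : Fin a) → ΣF (λ y → adj (c x y)) ≡ ΣF (degree c x)
Σadj c x = trans (ΣF-cong (λ y → adj≡Σδ (c x y))) (ΣF-swap (λ y i → δ (c x y) (suc i)))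

0<degree : (c : Colouring a b ℓ) {x : Fin a} {y : Fin b} {i : Fin ℓ} → c x y ≡ suc i → 0 < degree c x i
0<degree c {x} {y} {i} cxy =
  ≤-trans (≤-reflexive (sym (δ-≡ cxy))) (term≤ΣF (λ y → δ (c x y) (suc i)) y)

-- Realising bounded degree sequences

threshold : ℕ → ℕ → ℕ
threshold ℓ d = suc (3 * (ℓ * d * d))

module Realisation {a b ℓ d : ℕ} (r : Fin a → Fin ℓ → ℕ) (r′ : Fin b → Fin ℓ → ℕ)
  (r≤d : ∀ x i → r x i ≤ d) (r′≤d : ∀ y i → r′ y i ≤ d)
  (balanced : ∀ i → ΣF (λ x → r x i) ≡ ΣF (λ y → r′ y i))
  (large : ∀ i → ΣF (λ x → r x i) ≡ 0 ⊎ threshold ℓ d ≤ ΣF (λ x → r x i)) where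

  record Partial (c : Colouring a b ℓ) : Set where
    field
      left≤  : ∀ x i → degree c x i ≤ r x i
      right≤ : ∀ y i → degree (flip c) y i ≤ r′ y i

  -- c′ has one more edge of colour i, between x and y as far as degrees can tell.
  record Augmentation (c : Colouring a b ℓ) (i : Fin ℓ) : Set where
    field
      x       : Fin a
      y       : Fin b
      x-lacks : degree c x i < r x i
      y-lacks : degree (flip c) y i < r′ y i
      c′      : Colouring a b ℓ
      left    : ∀ x′ j → degree c′ x′ j ≡ degree c x′ j + δ x′ x * δ i j
      right   : ∀ y′ j → degree (flip c′) y′ j ≡ degree (flip c) y′ j + δ y′ y * δ i j

  -- Delete `x′ y′` and insert `x y′` and `x′ y`, all of colour `i`: the degrees of `x′` and `y′`
  -- are restored, those of `x` and `y` grow by one. The pairs are distinct because `x y` is joined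
  -- while `x′ y` and `x y′` are not.
  exchange : ∀ {c x y x′ y′ i} → degree c x i < r x i → degree (flip c) y i < r′ y i → c x y ≢ zero →
             c x′ y′ ≡ suc i → c x′ y ≡ zero → c x y′ ≡ zero → Augmentation c i
  exchange {c} {x} {y} {x′} {y′} {i} x-lacks y-lacks cxy cx′y′ cx′y cxy′ = record
    { x = x ; y = y ; x-lacks = x-lacks ; y-lacks = y-lacks ; c′ = c₃ ; left = left ; right = right }
    where
    x≢x′ : x ≢ x′
    x≢x′ x≡x′ = cxy (trans (cong (λ x → c x y) x≡x′) cx′y)
    y≢y′ : y ≢ y′
    y≢y′ y≡y′ = cxy (trans (cong (c x) y≡y′) cxy′)
    c₁ = set c x′ y′ zero
    c₂ = set c₁ x y′ (suc i)
    c₃ = set c₂ x′ y (suc i)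
    c₁xy′ : c₁ x y′ ≡ zero
    c₁xy′ = trans (set-row c x′ y′ zero y′ x≢x′) cxy′
    c₂x′y : c₂ x′ y ≡ zero
    c₂x′y = trans (set-column c₁ x y′ (suc i) x′ y≢y′) (trans (set-column c x′ y′ zero x′ y≢y′) cx′y)
    open ≡-Reasoning
    rearrange : ∀ D u v → (D + u) + v ≡ (D + v) + u
    rearrange = solve 3 (λ D u v → (D :+ u) :+ v := (D :+ v) :+ u) refl
      where open +-*-Solver
    left : ∀ z j → degree c₃ z j ≡ degree c z j + δ z x * δ i j
    left z j = begin
      degree c₃ z j                                        ≡⟨ degree-add c₂ x′ y i c₂x′y z j ⟩
      degree c₂ z j + δ z x′ * δ i j                       ≡⟨ cong (_+ δ z x′ * δ i j) (degree-add c₁ x y′ i c₁xy′ z j) ⟩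
      degree c₁ z j + δ z x * δ i j + δ z x′ * δ i j       ≡⟨ rearrange (degree c₁ z j) _ _ ⟩
      degree c₁ z j + δ z x′ * δ i j + δ z x * δ i j       ≡⟨ cong (_+ δ z x * δ i j) (degree-remove c x′ y′ i cx′y′ z j) ⟩
      degree c z j + δ z x * δ i j                         ∎
    right : ∀ z j → degree (flip c₃) z j ≡ degree (flip c) z j + δ z y * δ i j
    right z j = begin
      degree (flip c₃) z j                                  ≡⟨ degree-add′ c₂ x′ y i c₂x′y z j ⟩
      degree (flip c₂) z j + δ z y * δ i j                  ≡⟨ cong (_+ δ z y * δ i j) (degree-add′ c₁ x y′ i c₁xy′ z j) ⟩
      degree (flip c₁) z j + δ z y′ * δ i j + δ z y * δ i j ≡⟨ cong (_+ δ z y * δ i j) (degree-remove′ c x′ y′ i cx′y′ z j) ⟩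
      degree (flip c) z j + δ z y * δ i j                   ∎

  module _ {c : Colouring a b ℓ} (P : Partial c) where
    open Partial P

    left≤d : ∀ x i → degree c x i ≤ d
    left≤d x i = ≤-trans (left≤ x i) (r≤d x i)

    right≤d : ∀ y i → degree (flip c) y i ≤ d
    right≤d y i = ≤-trans (right≤ y i) (r′≤d y i)

    -- Each of the three groups below has at most ℓ d² edges: the missing edges at deficient
    -- vertices, and the edges of colour i whose exchange is blocked at y or at x.
    blocked⇒small : ∀ {x y i} → (∀ x′ → degree c x′ i < r x′ i → c x′ y ≢ zero) →
                    (∀ x′ y′ → c x′ y′ ≡ suc i → c x′ y ≢ zero ⊎ c x y′ ≢ zero) →
                    ΣF (λ x′ → r x′ i) < threshold ℓ d
    blocked⇒small {x} {y} {i} no-add no-swap = s≤s (begin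
      ΣF (λ x′ → r x′ i)
        ≤⟨ ΣF-mono deficit ⟩
      ΣF (λ x′ → degree c x′ i + adj (c x′ y) * d)
        ≡⟨ ΣF-+ (λ x′ → degree c x′ i) _ ⟩
      ΣF (λ x′ → degree c x′ i) + ΣF (λ x′ → adj (c x′ y) * d)
        ≤⟨ +-monoˡ-≤ (ΣF (λ x′ → adj (c x′ y) * d)) (ΣF-mono (λ x′ → ΣF-mono (blocked x′))) ⟩
      ΣF (λ x′ → ΣF (λ y′ → adj (c x′ y) * e x′ y′ + adj (c x y′) * e x′ y′)) + ΣF (λ x′ → adj (c x′ y) * d)
        ≡⟨ cong (_+ ΣF (λ x′ → adj (c x′ y) * d))
             (trans (ΣF-cong (λ x′ → ΣF-+ (λ y′ → adj (c x′ y) * e x′ y′) _)) (ΣF-+ {a} _ _)) ⟩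
      ΣF (λ x′ → ΣF (λ y′ → adj (c x′ y) * e x′ y′)) + ΣF (λ x′ → ΣF (λ y′ → adj (c x y′) * e x′ y′)) + ΣF (λ x′ → adj (c x′ y) * d)
        ≤⟨ +-mono-≤ (+-mono-≤ left-group right-group) left-bound ⟩
      ℓ * d * d + ℓ * d * d + ℓ * d * d
        ≡⟨ solve 1 (λ k → k :+ k :+ k := con 3 :* k) refl (ℓ * d * d) ⟩
      3 * (ℓ * d * d) ∎)
      where
      open ≤-Reasoning
      open +-*-Solver
      e : Fin a → Fin b → ℕ
      e x′ y′ = δ (c x′ y′) (suc i)

      nonzero : ∀ {f : Fin (suc ℓ)} → f ≢ zero → adj f ≡ 1
      nonzero {zero}  f≢0 = contradiction refl f≢0
      nonzero {suc _} _   = refl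

      -- A vertex short of colour `i` is joined to `y` by `no-add`, so its whole target, at most
      -- `d`, can be charged to that edge.
      deficit : ∀ x′ → r x′ i ≤ degree c x′ i + adj (c x′ y) * d
      deficit x′ with degree c x′ i <? r x′ i
      ... | no  full  = ≤-trans (≮⇒≥ full) (m≤m+n _ _)
      ... | yes lacks rewrite nonzero (no-add x′ lacks) | +-identityʳ d = ≤-trans (r≤d x′ i) (m≤n+m d _)

      blocked : ∀ x′ y′ → e x′ y′ ≤ adj (c x′ y) * e x′ y′ + adj (c x y′) * e x′ y′
      blocked x′ y′ with c x′ y′ ≟ suc i
      ... | no  _  = z≤n
      ... | yes eq with no-swap x′ y′ eq
      ...   | inj₁ ne rewrite nonzero ne = s≤s z≤n
      ...   | inj₂ ne rewrite nonzero ne = m≤n+m 1 _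

      -- `y` has at most `d` edges of each of the `ℓ` colours, and each of its neighbours is charged
      -- `d`.
      left-bound : ΣF (λ x′ → adj (c x′ y) * d) ≤ ℓ * d * d
      left-bound = begin
        ΣF (λ x′ → adj (c x′ y) * d)  ≡⟨ ΣF-*ʳ (λ x′ → adj (c x′ y)) d ⟩
        ΣF (λ x′ → adj (c x′ y)) * d  ≡⟨ cong (_* d) (Σadj (flip c) y) ⟩
        ΣF (degree (flip c) y) * d    ≤⟨ *-monoˡ-≤ d (ΣF-≤-* (right≤d y)) ⟩
        ℓ * d * d                     ∎

      left-group : ΣF (λ x′ → ΣF (λ y′ → adj (c x′ y) * e x′ y′)) ≤ ℓ * d * d
      left-group = ≤-trans (ΣF-mono (λ x′ → ≤-trans (≤-reflexive (ΣF-*ˡ (adj (c x′ y)) (e x′))) (*-monoʳ-≤ (adj (c x′ y)) (left≤d x′ i)))) left-bound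

      right-group : ΣF (λ x′ → ΣF (λ y′ → adj (c x y′) * e x′ y′)) ≤ ℓ * d * d
      right-group = begin
        ΣF (λ x′ → ΣF (λ y′ → adj (c x y′) * e x′ y′)) ≡⟨ ΣF-swap (λ x′ y′ → adj (c x y′) * e x′ y′) ⟩
        ΣF (λ y′ → ΣF (λ x′ → adj (c x y′) * e x′ y′)) ≤⟨ ΣF-mono (λ y′ → ≤-trans (≤-reflexive (ΣF-*ˡ (adj (c x y′)) (λ x′ → e x′ y′))) (*-monoʳ-≤ (adj (c x y′)) (right≤d y′ i))) ⟩
        ΣF (λ y′ → adj (c x y′) * d)                   ≡⟨ ΣF-*ʳ (λ y′ → adj (c x y′)) d ⟩
        ΣF (λ y′ → adj (c x y′)) * d                   ≡⟨ cong (_* d) (Σadj c x) ⟩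
        ΣF (degree c x) * d                            ≤⟨ *-monoˡ-≤ d (ΣF-≤-* (left≤d x)) ⟩
        ℓ * d * d                                      ∎

    augment : ∀ {x i} → degree c x i < r x i → Augmentation c i
    augment {x} {i} x-lacks
      -- Since `x` is short, the left total of colour `i` is below its target. Handshake and balance
      -- carry this to the right, where some `y` must be short as well.
      with y , y-lacks ← ΣF-<⇒∃ (λ y → degree (flip c) y i) (λ y → r′ y i)
             (subst₂ _<_ (handshake c i) (balanced i)
               (ΣF-mono-< (λ x′ → left≤ x′ i) x x-lacks))
      -- The new edge may start at any vertex short of colour `i`, not just at the given `x`. If
      -- none can be joined to `y`, then in particular `x y` is already an edge, as `exchange`
      -- requires.
      with any? (λ x′ → (degree c x′ i <? r x′ i) ×-dec (c x′ y ≟ zero))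
    ... | yes (x′ , x′-lacks , cx′y) = record
      { x = x′ ; y = y ; x-lacks = x′-lacks ; y-lacks = y-lacks ; c′ = set c x′ y (suc i)
      ; left = degree-add c x′ y i cx′y ; right = degree-add′ c x′ y i cx′y }
    ... | no no-add
      with any? (λ x′ → any? (λ y′ → (c x′ y′ ≟ suc i) ×-dec (c x′ y ≟ zero) ×-dec (c x y′ ≟ zero)))
    ...   | yes (x′ , y′ , e , f , g) = exchange x-lacks y-lacks (λ z → no-add (x , x-lacks , z)) e f g
    ...   | no no-swap with large i
    -- In a colour with total target 0 no vertex can be short.
    ...     | inj₁ none = contradiction (≤-trans (term≤ΣF (λ x → r x i) x) (≤-reflexive none)) (<⇒≱ (≤-<-trans z≤n x-lacks))
    ...     | inj₂ many = contradiction (blocked⇒small {x} {y} (λ x′ lacks z → no-add (x′ , lacks , z)) blocked) (≤⇒≯ many)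
      where
      blocked : ∀ x′ y′ → c x′ y′ ≡ suc i → c x′ y ≢ zero ⊎ c x y′ ≢ zero
      blocked x′ y′ e with c x′ y ≟ zero
      ... | no  f = inj₁ f
      ... | yes f = inj₂ (λ g → no-swap (x′ , y′ , e , f , g))

  edges : Colouring a b ℓ → ℕ
  edges c = ΣF (λ x → ΣF (degree c x))

  module _ {c : Colouring a b ℓ} {i : Fin ℓ} (P : Partial c) (aug : Augmentation c i) where
    open Partial P
    open Augmentation aug

    bump : ∀ {k} {s : Fin k → Fin ℓ → ℕ} {D D′ : Fin k → Fin ℓ → ℕ} {z : Fin k} → D z i < s z i →
           (∀ w j → D′ w j ≡ D w j + δ w z * δ i j) → (∀ w j → D w j ≤ s w j) → ∀ w j → D′ w j ≤ s w j
    bump {D = D} {z = z} lacks D′≡ D≤s w j with δ*δ-cases w z i j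
    ... | inj₁ (refl , refl , hit) rewrite D′≡ w j | hit | +-comm (D w j) 1 = lacks
    ... | inj₂ miss rewrite D′≡ w j | miss | +-identityʳ (D w j) = D≤s w j

    augmented : Partial c′
    augmented = record { left≤ = bump x-lacks left left≤ ; right≤ = bump y-lacks right right≤ }

    edges-augmented : edges c < edges c′
    edges-augmented = ΣF-mono-< (λ x′ → ΣF-mono (grows x′)) x (ΣF-mono-< (grows x) i strictly)
      where
      grows : ∀ x′ j → degree c x′ j ≤ degree c′ x′ j
      grows x′ j = ≤-trans (m≤m+n _ _) (≤-reflexive (sym (left x′ j)))
      strictly : degree c x i < degree c′ x i
      strictly rewrite left x i | δ-refl x | δ-refl i | +-comm (degree c x i) 1 = ≤-refl

  -- `fuel` bounds the number of edges still missing, and each augmentation adds one. Once the left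
  -- side is full, equal totals force the right side to be full too.
  complete : ∀ fuel {c} → Partial c → ΣF (λ x → ΣF (r x)) ≤ fuel + edges c →
             ∃ λ c → (∀ x i → degree c x i ≡ r x i) × (∀ y i → degree (flip c) y i ≡ r′ y i)
  complete fuel {c} P enough with any? (λ x → any? (λ i → degree c x i <? r x i))
  ... | no full = c , left-full , λ y i → ΣF-≤-antisym (λ y → right≤ y i) (total i) y
    where
    open Partial P
    left-full : ∀ x i → degree c x i ≡ r x i
    left-full x i = ≤-antisym (left≤ x i) (≮⇒≥ (λ lacks → full (x , i , lacks)))
    total : ∀ i → ΣF (λ y → r′ y i) ≤ ΣF (λ y → degree (flip c) y i)
    total i = ≤-reflexive (trans (sym (balanced i)) (trans (sym (ΣF-cong (λ x → left-full x i))) (handshake c i)))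
  complete zero {c} P enough | yes (x , i , lacks) =
    contradiction (ΣF-mono-< (λ x → ΣF-mono (left≤ x)) x (ΣF-mono-< (left≤ x) i lacks)) (≤⇒≯ enough)
    where open Partial P
  complete (suc fuel) {c} P enough | yes (x , i , lacks) =
    complete fuel (augmented P aug) (≤-trans enough
      (≤-trans (≤-reflexive (sym (+-suc fuel (edges c)))) (+-monoʳ-≤ fuel (edges-augmented P aug))))
    where aug = augment P lacks

  realise : ∃ λ c → (∀ x i → degree c x i ≡ r x i) × (∀ y i → degree (flip c) y i ≡ r′ y i)
  realise = complete (ΣF (λ x → ΣF (r x))) {λ _ _ → zero}
    (record { left≤ = λ x i → subst (_≤ r x i) (sym (ΣF-0 b)) z≤n
            ; right≤ = λ y i → subst (_≤ r′ y i) (sym (ΣF-0 a)) z≤n })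
    (m≤m+n _ (edges (λ _ _ → zero)))

-- Normalising a completion

descend : {G : Set} (Inv Done : G → Set) (μ : G → ℕ) →
          (∀ g → Inv g → Done g ⊎ ∃ λ g′ → Inv g′ × μ g′ < μ g) →
          ∀ g → Inv g → ∃ λ g′ → Inv g′ × Done g′
descend {G} Inv Done μ step g₀ inv₀ = go (μ g₀) g₀ inv₀ ≤-refl
  where
  go : ∀ fuel g → Inv g → μ g ≤ fuel → ∃ λ g′ → Inv g′ × Done g′
  go fuel g inv μ≤ with step g inv
  ... | inj₁ done = g , inv , done
  go zero       g inv μ≤ | inj₂ (g′ , inv′ , μ<) = contradiction (≤-trans μ< μ≤) λ ()
  go (suc fuel) g inv μ≤ | inj₂ (g′ , inv′ , μ<) = go fuel g′ inv′ (≤-pred (≤-trans μ< μ≤))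

-- The slack that allows an edge to be removed. An exact demand never has any, so a surplus also
-- reveals that the demand is a lower bound.
Surplus : 𝔹 → ℕ → Set
Surplus (exactly _) n = ⊥
Surplus (atLeast e) n = e < n

surplus? : ∀ β n → Dec (Surplus β n)
surplus? (exactly _) n = no λ ()
surplus? (atLeast e) n = e <? n

surplus-suc⇒≐ : ∀ β {n} → Surplus β (suc n) → n ≐ β
surplus-suc⇒≐ (atLeast e) = ≤-pred

-- The surplus, observed at another degree `n′`, identifies `β` as a lower bound; such a demand
-- stays satisfied when `n` grows.
surplus⇒suc≐ : ∀ β {n n′} → Surplus β n′ → n ≐ β → suc n ≐ β
surplus⇒suc≐ (atLeast e) _ = m≤n⇒m≤1+n

surplus-mono : ∀ β {n n′} → n ≤ n′ → Surplus β n → Surplus β n′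
surplus-mono (atLeast e) n≤n′ e<n = ≤-trans e<n n≤n′

¬surplus⇒≤ : ∀ β {n} → n ≐ β → ¬ Surplus β n → n ≤ ⌊ β ⌋
¬surplus⇒≤ (exactly e) n≡e _   = ≤-reflexive n≡e
¬surplus⇒≤ (atLeast e) _   ¬sp = ≮⇒≥ ¬sp

module _ {β : Fin k → Fin ℓ → 𝔹} {D D′ : Fin k → Fin ℓ → ℕ} (z : Fin k) (i : Fin ℓ) where

  ≐-lower : (∀ w j → D′ w j + δ w z * δ i j ≡ D w j) → Surplus (β z i) (D z i) →
            (∀ w j → D w j ≐ β w j) → ∀ w j → D′ w j ≐ β w j
  ≐-lower D′≡ spare D≐ w j with δ*δ-cases w z i j
  ... | inj₂ miss = subst (_≐ β w j) (trans (sym (D′≡ w j)) (trans (cong (D′ w j +_) miss) (+-identityʳ _))) (D≐ w j)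
  ... | inj₁ (refl , refl , hit) = surplus-suc⇒≐ (β w j)
    (subst (Surplus (β w j)) (trans (sym (D′≡ w j)) (trans (cong (D′ w j +_) hit) (+-comm _ 1))) spare)

  ≐-raise : (∀ w j → D′ w j ≡ D w j + δ w z * δ i j) → ∀ {n} → Surplus (β z i) n →
            (∀ w j → D w j ≐ β w j) → ∀ w j → D′ w j ≐ β w j
  ≐-raise D′≡ spare D≐ w j with δ*δ-cases w z i j
  ... | inj₂ miss = subst (_≐ β w j) (sym (trans (D′≡ w j) (trans (cong (D w j +_) miss) (+-identityʳ _)))) (D≐ w j)
  ... | inj₁ (refl , refl , hit) = subst (_≐ β w j)
    (sym (trans (D′≡ w j) (trans (cong (D w j +_) hit) (+-comm _ 1)))) (surplus⇒suc≐ (β w j) spare (D≐ w j))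

-- Demands hang on classes, so that an edge can be moved from one vertex to another of the same
-- class.
record Side (ℓ d : ℕ) : Set where
  field
    {size classes} : ℕ
    class          : Fin size → Fin classes
    demand         : Fin classes → Fin ℓ → 𝔹
    demand≤d       : ∀ j i → ⌊ demand j i ⌋ ≤ d

  required : Fin size → Fin ℓ → 𝔹
  required x = demand (class x)

open Side

private variable
  d : ℕ

Graph : Side ℓ d → Side ℓ d → Set
Graph {ℓ} L R = Colouring (size L) (size R) ℓ

Satisfies : (L R : Side ℓ d) → Graph L R → Set
Satisfies L R c = ∀ x i → degree c x i ≐ required L x i

Excess : (L R : Side ℓ d) → Graph L R → Fin (size L) → Fin ℓ → Set
Excess L R c x i = Surplus (required L x i) (degree c x i)

excess? : (L R : Side ℓ d) (c : Graph L R) → ∀ x i → Dec (Excess L R c x i)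
excess? L R c x i = surplus? (required L x i) (degree c x i)

tight⇒≤d : (L R : Side ℓ d) (c : Graph L R) → Satisfies L R c →
           ∀ {x i} → ¬ Excess L R c x i → degree c x i ≤ d
tight⇒≤d L R c sat {x} {i} tight =
  ≤-trans (¬surplus⇒≤ (required L x i) (sat x i) tight) (demand≤d L (class L x) i)

tightness : (L R : Side ℓ d) → Graph L R → Fin (size L) → Fin ℓ → ℕ
tightness L R c x i = 𝟙 (not (does (excess? L R c x i)))

tight⇒1 : (L R : Side ℓ d) (c : Graph L R) → ∀ {x i} → ¬ Excess L R c x i → tightness L R c x i ≡ 1
tight⇒1 L R c {x} {i} tight = cong (𝟙 ∘ not) (dec-false (excess? L R c x i) tight)

-- A colour without surplus at `x` has degree at most its demand, hence at most `d`; colours with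
-- surplus are masked out.
tight-degrees : (L R : Side ℓ d) (c : Graph L R) → Satisfies L R c →
                ∀ x → ΣF (λ i → tightness L R c x i * degree c x i) ≤ ℓ * d
tight-degrees {d = d} L R c sat x = ΣF-≤-* bound
  where
  bound : ∀ i → tightness L R c x i * degree c x i ≤ d
  bound i with excess? L R c x i
  ... | yes _    = z≤n
  ... | no tight = ≤-trans (≤-reflexive (*-identityˡ _)) (tight⇒≤d L R c sat tight)

module _ {ℓ d : ℕ} (L R : Side ℓ d) where

  Minimal : Graph L R → Set
  Minimal c = ∀ x y i → c x y ≡ suc i → Excess L R c x i → ¬ Excess R L (flip c) y i

  -- An edge with surplus at both ends can be deleted without violating any demand, and the number
  -- of edges drops.
  minimise : ∀ c → Satisfies L R c × Satisfies R L (flip c) →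
             ∃ λ c → (Satisfies L R c × Satisfies R L (flip c)) × Minimal c
  minimise = descend _ Minimal (λ c → ΣF (λ x → ΣF (λ y → adj (c x y)))) step
    where
    step : ∀ c → Satisfies L R c × Satisfies R L (flip c) → Minimal c ⊎
           ∃ λ c′ → (Satisfies L R c′ × Satisfies R L (flip c′)) ×
                    ΣF (λ x → ΣF (λ y → adj (c′ x y))) < ΣF (λ x → ΣF (λ y → adj (c x y)))
    step c (satL , satR)
      with any? (λ x → any? (λ y → any? (λ i →
             (c x y ≟ suc i) ×-dec excess? L R c x i ×-dec excess? R L (flip c) y i)))
    ... | no none = inj₁ (λ x y i e f g → none (x , y , i , e , f , g))
    ... | yes (x , y , i , cxy , spareL , spareR) = inj₂
      ( set c x y zero
      , ( ≐-lower x i (degree-remove c x y i cxy) spareL satL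
        , ≐-lower y i (degree-remove′ c x y i cxy) spareR satR )
      , ΣF-mono-< (λ x′ → ΣF-mono (shrinks x′)) x (ΣF-mono-< (shrinks x) y strictly) )
      where
      shrinks : ∀ x′ y′ → adj (set c x y zero x′ y′) ≤ adj (c x′ y′)
      shrinks x′ y′ with set-cases c x y zero x′ y′
      ... | inj₁ (_ , _ , eq) rewrite eq = z≤n
      ... | inj₂ eq rewrite eq = ≤-refl
      strictly : adj (set c x y zero x y) < adj (c x y)
      strictly rewrite set-here c x y zero | cxy = ≤-refl

-- The core of a side consists of the vertices that a scheme will name individually; its
-- reservoir absorbs redirected edges.
record Core {ℓ d : ℕ} (L : Side ℓ d) : Set where
  field
    core reservoir : Fin (size L) → Bool
    reservoir⊆core : ∀ {x} → reservoir x ≡ true → core x ≡ true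
    plentiful      : ∀ {x} → core x ≡ false →
                     ℓ * d ≤ ΣF (λ x′ → 𝟙 (reservoir x′) * δ (class L x′) (class L x))

  ∉core⇒∉reservoir : ∀ {x} → core x ≡ false → reservoir x ≡ true → ⊥
  ∉core⇒∉reservoir out in-reservoir with () ← trans (sym out) (reservoir⊆core in-reservoir)

open Core

-- The properties that redirection preserves. By `tight-left` and `tight-right`, edges from a vertex
-- outside the core to the opposite reservoir are tight at the outside end, so there are at most
-- `ℓ * d` of them at each such vertex.
record Invariant {ℓ d : ℕ} {L R : Side ℓ d} (𝒜 : Core L) (ℬ : Core R) (c : Graph L R) : Set where
  field
    satL       : Satisfies L R c
    satR       : Satisfies R L (flip c)
    one-tight  : ∀ {x y i} → core 𝒜 x ≡ false → core ℬ y ≡ false → c x y ≡ suc i →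
                 Excess L R c x i → ¬ Excess R L (flip c) y i
    tight-left  : ∀ {x y i} → core 𝒜 x ≡ false → reservoir ℬ y ≡ true → c x y ≡ suc i →
                  ¬ Excess L R c x i
    tight-right : ∀ {x y i} → reservoir 𝒜 x ≡ true → core ℬ y ≡ false → c x y ≡ suc i →
                  ¬ Excess R L (flip c) y i

transpose : {L R : Side ℓ d} {𝒜 : Core L} {ℬ : Core R} {c : Graph L R} →
            Invariant 𝒜 ℬ c → Invariant ℬ 𝒜 (flip c)
transpose inv = record
  { satL = satR ; satR = satL
  ; one-tight = λ y∉ x∉ cxy f g → one-tight x∉ y∉ cxy g f
  ; tight-left = λ y∉ x∈ → tight-right x∈ y∉ ; tight-right = λ y∈ x∉ → tight-left x∉ y∈ }
  where open Invariant inv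

-- This is what makes `inner-size` drop: new edges may appear only at core vertices.
record Shrinks {ℓ d : ℕ} {L R : Side ℓ d} (𝒜 : Core L) (ℬ : Core R) (c c′ : Graph L R)
               (x : Fin (size L)) (y : Fin (size R)) : Set where
  field
    x∉      : core 𝒜 x ≡ false
    y∉      : core ℬ y ≡ false
    removed : c′ x y ≡ zero
    kept    : ∀ {x′ y′} → core 𝒜 x′ ≡ false → core ℬ y′ ≡ false →
              c′ x′ y′ ≡ zero ⊎ c′ x′ y′ ≡ c x′ y′

module _ {ℓ d : ℕ} {L R : Side ℓ d} (𝒜 : Core L) (ℬ : Core R) {c : Graph L R} (inv : Invariant 𝒜 ℬ c) where
  open Invariant inv

  -- All edges from `x` to the reservoir are tight at `x`, and so is the edge to `y`, which lies
  -- outside the reservoir. At most `ℓ * d` edges are tight at `x`, so fewer than `ℓ * d` lead to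
  -- the reservoir, while the class of `y` has at least `ℓ * d` reservoir vertices.
  free-neighbour : ∀ {x y i} → core 𝒜 x ≡ false → core ℬ y ≡ false → c x y ≡ suc i →
                   ¬ Excess L R c x i →
                   ∃ λ y′ → reservoir ℬ y′ ≡ true × class R y′ ≡ class R y × c x y′ ≡ zero
  free-neighbour {x} {y} {i} x∉ y∉ cxy tight =
    let y′ , free = ΣF-<⇒∃ (λ y′ → same y′ * adj (c x y′)) same few in y′ , unpack free
    where
    same : Fin (size R) → ℕ
    same y′ = 𝟙 (reservoir ℬ y′) * δ (class R y′) (class R y)

    unpack : ∀ {y′} → same y′ * adj (c x y′) < same y′ →
             reservoir ℬ y′ ≡ true × class R y′ ≡ class R y × c x y′ ≡ zero
    unpack {y′} lt with reservoir ℬ y′ | class R y′ ≟ class R y | c x y′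
    unpack lt | true | yes eq | zero  = refl , eq , refl
    unpack (s≤s ()) | true | yes eq | suc _

    tight-edges : Fin (size R) → ℕ
    tight-edges y′ = ΣF (λ j → tightness L R c x j * δ (c x y′) (suc j))

    tight-edge : ∀ {y′ j} → c x y′ ≡ suc j → ¬ Excess L R c x j → 1 ≤ tight-edges y′
    tight-edge {y′} {j} cxy′ tightⱼ = ≤-trans
      (≤-reflexive (sym (cong₂ _*_ (tight⇒1 L R c tightⱼ) (δ-≡ cxy′))))
      (term≤ΣF (λ j → tightness L R c x j * δ (c x y′) (suc j)) j)

    -- The summand `δ y′ y` accounts for the edge to `y` itself and makes the final inequality
    -- strict.
    pointwise : ∀ y′ → same y′ * adj (c x y′) + δ y′ y ≤ tight-edges y′
    pointwise y′ with y′ ≟ y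
    ... | yes refl with reservoir ℬ y in y∈
    ...   | true  = ⊥-elim (∉core⇒∉reservoir ℬ y∉ y∈)
    ...   | false = tight-edge cxy tight
    pointwise y′ | no _ rewrite +-identityʳ (same y′ * adj (c x y′)) with reservoir ℬ y′ in y′∈
    ... | false = z≤n
    ... | true with c x y′ in cxy′
    ...   | zero  = ≤-trans (≤-reflexive (*-zeroʳ (δ (class R y′) (class R y) + 0))) z≤n
    ...   | suc j = ≤-trans (≤-trans (≤-reflexive (trans (*-identityʳ _) (+-identityʳ _))) (𝟙≤1 (does (class R y′ ≟ class R y))))
                     (subst (λ e → 1 ≤ ΣF (λ j → tightness L R c x j * δ e (suc j))) cxy′
                       (tight-edge cxy′ (tight-left x∉ y′∈ cxy′)))

    few : ΣF (λ y′ → same y′ * adj (c x y′)) < ΣF same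
    few = begin-strict
      ΣF (λ y′ → same y′ * adj (c x y′))
        <⟨ ≤-reflexive (trans (+-comm 1 _) (cong (ΣF (λ y′ → same y′ * adj (c x y′)) +_) (sym (trans (ΣF-cong (λ y′ → δ-sym y′ y)) (ΣF-δ₁ y))))) ⟩
      ΣF (λ y′ → same y′ * adj (c x y′)) + ΣF (λ y′ → δ y′ y)
        ≡⟨ ΣF-+ (λ y′ → same y′ * adj (c x y′)) (λ y′ → δ y′ y) ⟨
      ΣF (λ y′ → same y′ * adj (c x y′) + δ y′ y)
        ≤⟨ ΣF-mono pointwise ⟩
      ΣF (λ y′ → ΣF (λ j → tightness L R c x j * δ (c x y′) (suc j)))
        ≡⟨ ΣF-swap (λ y′ j → tightness L R c x j * δ (c x y′) (suc j)) ⟩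
      ΣF (λ j → ΣF (λ y′ → tightness L R c x j * δ (c x y′) (suc j)))
        ≡⟨ ΣF-cong (λ j → ΣF-*ˡ (tightness L R c x j) (λ y′ → δ (c x y′) (suc j))) ⟩
      ΣF (λ j → tightness L R c x j * degree c x j)
        ≤⟨ tight-degrees L R c satL x ⟩
      ℓ * d
        ≤⟨ plentiful ℬ y∉ ⟩
      ΣF same ∎
      where open ≤-Reasoning

  -- Replace `x y` by `x y′` with `y′` from `free-neighbour`. The degree of `x` is unchanged, `y`
  -- gives up part of its surplus, and `y′` may exceed its lower bound. As `y′` is in the core, no
  -- edge outside the core is created.
  redirect : ∀ {x y i} → core 𝒜 x ≡ false → core ℬ y ≡ false → c x y ≡ suc i →
             Excess R L (flip c) y i → ∃ λ c′ → Invariant 𝒜 ℬ c′ × Shrinks 𝒜 ℬ c c′ x y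
  redirect {x} {y} {i} x∉ y∉ cxy spare
    with tight ← (λ f → one-tight x∉ y∉ cxy f spare)
    with y′ , y′∈ , same-class , cxy′ ← free-neighbour x∉ y∉ cxy tight
    = c₂ , record
      { satL = λ w j → subst (_≐ required L w j) (sym (left w j)) (satL w j)
      -- The surplus at `y` shows that the demand of the shared class is a lower bound, so `y′` can
      -- take one more edge.
      ; satR = ≐-raise y′ i right₂ (subst (λ k → Surplus (demand R k i) _) (sym same-class) spare)
                 (≐-lower y i (degree-remove′ c x y i cxy) spare satR)
      ; one-tight = λ {w} w∉ v∉ e f g → let v≢y′ = ∉⇒≢y′ v∉ in
          one-tight w∉ v∉ (old w v≢y′ e) (tightL f) (tightR v≢y′ g)
      ; tight-left = λ w∉ v∈ e f → tight-left′ w∉ v∈ e (tightL f)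
      ; tight-right = λ {w} w∈ v∉ e g → let v≢y′ = ∉⇒≢y′ v∉ in
          tight-right w∈ v∉ (old w v≢y′ e) (tightR v≢y′ g)
      } , record
      { x∉ = x∉ ; y∉ = y∉
      ; removed = trans (set-column c₁ x y′ (suc i) x (∉⇒≢y′ y∉)) (set-here c x y zero)
      ; kept = λ {w} {v} w∉ v∉ → kept w v (∉⇒≢y′ v∉)
      }
    where
    c₁ = set c x y zero
    c₂ = set c₁ x y′ (suc i)

    ∉⇒≢y′ : ∀ {v} → core ℬ v ≡ false → v ≢ y′
    ∉⇒≢y′ v∉ refl = ∉core⇒∉reservoir ℬ v∉ y′∈

    c₁xy′ : c₁ x y′ ≡ zero
    c₁xy′ = trans (set-column c x y zero x (∉⇒≢y′ y∉ ∘ sym)) cxy′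

    left : ∀ w j → degree c₂ w j ≡ degree c w j
    left w j = trans (degree-add c₁ x y′ i c₁xy′ w j) (degree-remove c x y i cxy w j)

    right₂ : ∀ v j → degree (flip c₂) v j ≡ degree (flip c₁) v j + δ v y′ * δ i j
    right₂ = degree-add′ c₁ x y′ i c₁xy′

    -- Away from `y′` right degrees can only fall, so no new surplus arises at a vertex outside the
    -- core.
    right : ∀ {v} → v ≢ y′ → ∀ j → degree (flip c₂) v j ≤ degree (flip c) v j
    right {v} v≢y′ j = begin
      degree (flip c₂) v j                  ≡⟨ right₂ v j ⟩
      degree (flip c₁) v j + δ v y′ * δ i j ≡⟨ cong (λ e → degree (flip c₁) v j + e * δ i j) (δ-≢ v≢y′) ⟩
      degree (flip c₁) v j + 0              ≤⟨ +-monoʳ-≤ (degree (flip c₁) v j) z≤n ⟩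
      degree (flip c₁) v j + δ v y * δ i j  ≡⟨ degree-remove′ c x y i cxy v j ⟩
      degree (flip c) v j                   ∎
      where open ≤-Reasoning

    tightL : ∀ {w j} → Excess L R c₂ w j → Excess L R c w j
    tightL {w} {j} = subst (Surplus (required L w j)) (left w j)

    tightR : ∀ {v j} → v ≢ y′ → Excess R L (flip c₂) v j → Excess R L (flip c) v j
    tightR {v} {j} v≢y′ = surplus-mono (required R v j) (right v≢y′ j)

    kept : ∀ w v → v ≢ y′ → c₂ w v ≡ zero ⊎ c₂ w v ≡ c w v
    kept w v v≢y′ rewrite set-column c₁ x y′ (suc i) w v≢y′ with set-cases c x y zero w v
    ... | inj₁ (_ , _ , eq) = inj₁ eq
    ... | inj₂ eq           = inj₂ eq

    old : ∀ w {v j} → v ≢ y′ → c₂ w v ≡ suc j → c w v ≡ suc j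
    old w {v} v≢y′ e with kept w v v≢y′
    ... | inj₂ eq = trans (sym eq) e
    ... | inj₁ eq with () ← trans (sym eq) e

    -- The only new edge into the reservoir starts at `x`, which is tight in colour `i`.
    tight-left′ : ∀ {w v j} → core 𝒜 w ≡ false → reservoir ℬ v ≡ true → c₂ w v ≡ suc j → ¬ Excess L R c w j
    tight-left′ {w} {v} w∉ v∈ e with set-cases c₁ x y′ (suc i) w v
    ... | inj₁ (refl , _ , eq) = subst (λ j → ¬ Excess L R c w j) (suc-injective (trans (sym eq) e)) tight
    ... | inj₂ eq = tight-left w∉ v∈
      (trans (sym (set-column c x y zero w (λ v≡y → ∉core⇒∉reservoir ℬ y∉ (subst (λ v → reservoir ℬ v ≡ true) v≡y v∈)))) (trans (sym eq) e))

module _ (A : Fin a → Bool) (B : Fin b → Bool) (c : Colouring a b ℓ) where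

  -- With `A` and `B` as cores, these edges will be remembered only through their degrees, whereas
  -- the states record every edge of `outer`.
  inner : Colouring a b ℓ
  inner x y = if A x ∨ B y then zero else c x y

  outer : Colouring a b ℓ
  outer x y = if A x ∨ B y then c x y else zero

  inner-edge : ∀ {x y i} → inner x y ≡ suc i → A x ≡ false × B y ≡ false × c x y ≡ suc i
  inner-edge {x} {y} e with A x | B y
  ... | false | false = refl , refl , e

  inner-δ≤ : ∀ x y i → δ (inner x y) (suc i) ≤ δ (c x y) (suc i)
  inner-δ≤ x y i with A x ∨ B y
  ... | true  = z≤n
  ... | false = ≤-refl

  outer+inner : ∀ x i → degree outer x i + degree inner x i ≡ degree c x i
  outer+inner x i = trans (sym (ΣF-+ (λ y → δ (outer x y) (suc i)) _)) (ΣF-cong pointwise)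
    where
    pointwise : ∀ y → δ (outer x y) (suc i) + δ (inner x y) (suc i) ≡ δ (c x y) (suc i)
    pointwise y with A x ∨ B y
    ... | true  = +-identityʳ _
    ... | false = refl

inner-outer-flip : (A : Fin a → Bool) (B : Fin b → Bool) (c : Colouring a b ℓ) → ∀ x y →
         inner A B c x y ≡ inner B A (flip c) y x × outer A B c x y ≡ outer B A (flip c) y x
inner-outer-flip A B c x y with A x | B y
... | true  | true  = refl , refl
... | true  | false = refl , refl
... | false | true  = refl , refl
... | false | false = refl , refl

Tight : (L R : Side ℓ d) → (Fin (size L) → Bool) → (Fin (size R) → Bool) → Graph L R → Set
Tight L R A B c = ∀ {x y i} → A x ≡ false → B y ≡ false → c x y ≡ suc i →
                  ¬ Excess L R c x i × ¬ Excess R L (flip c) y i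

module _ {ℓ d : ℕ} {L R : Side ℓ d} (𝒜 : Core L) (ℬ : Core R) where

  inner-size : Graph L R → ℕ
  inner-size c = ΣF (λ x → ΣF (λ y → adj (inner (core 𝒜) (core ℬ) c x y)))

  shrinks⇒< : ∀ {c c′ x y i} → c x y ≡ suc i → Shrinks 𝒜 ℬ c c′ x y → inner-size c′ < inner-size c
  shrinks⇒< {c} {c′} {x} {y} cxy sh =
    ΣF-mono-< (λ x′ → ΣF-mono (shrink x′)) x (ΣF-mono-< (shrink x) y strictly)
    where
    open Shrinks sh
    shrink : ∀ x′ y′ → adj (inner (core 𝒜) (core ℬ) c′ x′ y′) ≤ adj (inner (core 𝒜) (core ℬ) c x′ y′)
    shrink x′ y′ with core 𝒜 x′ in x′∉ | core ℬ y′ in y′∉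
    ... | true  | _    = z≤n
    ... | false | true = z≤n
    ... | false | false with kept x′∉ y′∉
    ...   | inj₁ eq rewrite eq = z≤n
    ...   | inj₂ eq rewrite eq = ≤-refl
    strictly : adj (inner (core 𝒜) (core ℬ) c′ x y) < adj (inner (core 𝒜) (core ℬ) c x y)
    strictly rewrite x∉ | y∉ | removed | cxy = ≤-refl

  -- Each redirection takes an edge out of the region outside both cores. A surplus at the left end
  -- is treated by exchanging the two sides.
  tighten : ∀ c → Invariant 𝒜 ℬ c → ∃ λ c → Invariant 𝒜 ℬ c × Tight L R (core 𝒜) (core ℬ) c
  tighten = descend _ (Tight L R (core 𝒜) (core ℬ)) inner-size step
    where
    step : ∀ c → Invariant 𝒜 ℬ c → Tight L R (core 𝒜) (core ℬ) c ⊎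
           ∃ λ c′ → Invariant 𝒜 ℬ c′ × inner-size c′ < inner-size c
    step c inv
      with any? (λ x → any? (λ y → any? (λ i → (core 𝒜 x ≟ᵇ false) ×-dec (core ℬ y ≟ᵇ false) ×-dec
             (c x y ≟ suc i) ×-dec (excess? L R c x i ⊎-dec excess? R L (flip c) y i))))
    ... | no none = inj₁ (λ x∉ y∉ e → (λ f → none (_ , _ , _ , x∉ , y∉ , e , inj₁ f)) ,
                                      (λ f → none (_ , _ , _ , x∉ , y∉ , e , inj₂ f)))
    ... | yes (x , y , i , x∉ , y∉ , e , inj₂ spare) =
      let c′ , inv′ , sh = redirect 𝒜 ℬ inv x∉ y∉ e spare in inj₂ (c′ , inv′ , shrinks⇒< e sh)
    ... | yes (x , y , i , x∉ , y∉ , e , inj₁ spare) =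
      let c′ , inv′ , sh = redirect ℬ 𝒜 (transpose inv) y∉ x∉ e spare in
        inj₂ (flip c′ , transpose inv′ , shrinks⇒< e (record
          { x∉ = x∉ ; y∉ = y∉ ; removed = Shrinks.removed sh
          ; kept = λ x′∉ y′∉ → Shrinks.kept sh y′∉ x′∉ }))

-- Greedy: elements of `P` are taken in order until `N` are found or `P` is exhausted.
choose : ∀ N (P : Fin a → Bool) → ∃ λ (Q : Fin a → Bool) → countF Q ≤ N ×
         (∀ x → Q x ≡ true → P x ≡ true) × ((∀ x → P x ≡ true → Q x ≡ true) ⊎ countF Q ≡ N)
choose {zero}  N P = P , z≤n , (λ ()) , inj₁ λ ()
choose {suc a} N P with P zero in P0
... | false with Q , few , Q⊆P , rest ← choose N (P ∘ suc) =
  (false ∷ Q) , few , (λ { (suc x) → Q⊆P x }) ,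
  [ (λ P⊆Q → inj₁ λ { zero P0′ → trans (sym P0) P0′ ; (suc x) → P⊆Q x }) , inj₂ ]′ rest
choose {suc a} zero P | true =
  (λ _ → false) , ≤-reflexive (ΣF-0 a) , (λ _ ()) , inj₂ (ΣF-0 a)
choose {suc a} (suc N) P | true with Q , few , Q⊆P , rest ← choose N (P ∘ suc) =
  (true ∷ Q) , s≤s few , (λ { zero _ → P0 ; (suc x) → Q⊆P x }) ,
  [ (λ P⊆Q → inj₁ λ { zero _ → refl ; (suc x) → P⊆Q x }) , inj₂ ∘ cong suc ]′ rest

-- If some vertex is left out, its class was not exhausted, so exactly `N` vertices of that class
-- were chosen.
choose-per-class : ∀ N (cl : Fin a → Fin m) → ∃ λ (A : Fin a → Bool) → countF A ≤ m * N ×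
                   (∀ {x} → A x ≡ false → N ≤ ΣF (λ x′ → 𝟙 (A x′) * δ (cl x′) (cl x)))
choose-per-class {a} {m} N cl = A , small , plenty
  where
  member : Fin m → Fin a → Bool
  member j x = does (cl x ≟ j)
  Q : Fin m → Fin a → Bool
  Q j = proj₁ (choose N (member j))
  A : Fin a → Bool
  A x = Q (cl x) x
  small : countF A ≤ m * N
  small = begin
    ΣF (λ x → 𝟙 (Q (cl x) x))             ≤⟨ ΣF-mono (λ x → term≤ΣF (λ j → 𝟙 (Q j x)) (cl x)) ⟩
    ΣF (λ x → ΣF (λ j → 𝟙 (Q j x)))       ≡⟨ ΣF-swap (λ x j → 𝟙 (Q j x)) ⟩
    ΣF (λ j → countF (Q j))               ≤⟨ ΣF-≤-* (λ j → proj₁ (proj₂ (choose N (member j)))) ⟩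
    m * N                                 ∎
    where open ≤-Reasoning
  plenty : ∀ {x} → A x ≡ false → N ≤ ΣF (λ x′ → 𝟙 (A x′) * δ (cl x′) (cl x))
  plenty {x} x∉ with proj₂ (proj₂ (choose N (member (cl x))))
  ... | Q⊆ , inj₁ ⊆Q with () ← trans (sym x∉) (⊆Q x (dec-true (cl x ≟ cl x) refl))
  ... | Q⊆ , inj₂ full = ≤-trans (≤-reflexive (sym full)) (ΣF-mono pointwise)
    where
    pointwise : ∀ x′ → 𝟙 (Q (cl x) x′) ≤ 𝟙 (A x′) * δ (cl x′) (cl x)
    pointwise x′ with Q (cl x) x′ in x′∈
    ... | false = z≤n
    ... | true with cl x′ ≟ cl x | Q⊆ x′ x′∈
    ...   | yes eq | _ rewrite eq | x′∈ = ≤-refl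

module _ {ℓ d : ℕ} (L R : Side ℓ d) where

  -- The first summand bounds the own reservoir, with `ℓ * d` vertices per class. The second allows
  -- `ℓ * d` tight neighbours for each vertex of the opposite reservoir.
  core-bound : ℕ
  core-bound = classes L * (ℓ * d) + classes R * (ℓ * d) * (ℓ * d)

  -- Few vertices are added to the reservoir A: a vertex of B has at most ℓ d tight edges.
  build-core : (c : Graph L R) → Satisfies R L (flip c) →
    (A : Fin (size L) → Bool) → countF A ≤ classes L * (ℓ * d) →
    (∀ {x} → A x ≡ false → ℓ * d ≤ ΣF (λ x′ → 𝟙 (A x′) * δ (class L x′) (class L x))) →
    (B : Fin (size R) → Bool) → countF B ≤ classes R * (ℓ * d) →
    Σ (Core L) λ 𝒜 → reservoir 𝒜 ≡ A × countF (core 𝒜) ≤ core-bound ×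
      (∀ {x y i} → core 𝒜 x ≡ false → B y ≡ true → c x y ≡ suc i → Excess R L (flip c) y i)
  build-core c satR A A-small plenty B B-small = record
    { core = core′ ; reservoir = A
    ; reservoir⊆core = λ x∈ → cong (_∨ _) x∈
    ; plentiful = λ {x} x∉ → plenty (∨-falseˡ (A x) x∉)
    } , refl , small , λ {x} x∉ y∈ e → excess x x∉ y∈ e
    where
    Touched : Fin (size L) → Set
    Touched x = ∃ λ y → ∃ λ i → B y ≡ true × c x y ≡ suc i × ¬ Excess R L (flip c) y i
    touched? : ∀ x → Dec (Touched x)
    touched? x = any? (λ y → any? (λ i → (B y ≟ᵇ true) ×-dec (c x y ≟ suc i) ×-dec ¬? (excess? R L (flip c) y i)))
    core′ : Fin (size L) → Bool
    core′ x = A x ∨ does (touched? x)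

    ∨-falseˡ : ∀ u {v} → u ∨ v ≡ false → u ≡ false
    ∨-falseˡ false _ = refl

    excess : ∀ x {y i} → core′ x ≡ false → B y ≡ true → c x y ≡ suc i → Excess R L (flip c) y i
    excess x {y} {i} x∉ y∈ e with A x | touched? x
    ... | false | no untouched with excess? R L (flip c) y i
    ...   | yes f = f
    ...   | no ¬f = ⊥-elim (untouched (y , i , y∈ , e , ¬f))

    hits : Fin (size L) → Fin (size R) → ℕ
    hits x y = ΣF (λ i → 𝟙 (B y) * (tightness R L (flip c) y i * δ (c x y) (suc i)))

    touched-hit : ∀ x → 𝟙 (does (touched? x)) ≤ ΣF (hits x)
    touched-hit x with touched? x
    ... | no _ = z≤n
    ... | yes (y , i , y∈ , e , tight) = begin
      1 ≡⟨ cong₂ _*_ (cong 𝟙 y∈) (cong₂ _*_ (tight⇒1 R L (flip c) tight) (δ-≡ e)) ⟨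
      𝟙 (B y) * (tightness R L (flip c) y i * δ (c x y) (suc i))
        ≤⟨ term≤ΣF (λ i → 𝟙 (B y) * (tightness R L (flip c) y i * δ (c x y) (suc i))) i ⟩
      hits x y ≤⟨ term≤ΣF (hits x) y ⟩
      ΣF (hits x) ∎
      where open ≤-Reasoning

    𝟙-∨ : ∀ u v → 𝟙 (u ∨ v) ≤ 𝟙 u + 𝟙 v
    𝟙-∨ true  v = m≤m+n 1 _
    𝟙-∨ false v = ≤-refl

    column : ∀ y → ΣF (λ x → hits x y) ≤ 𝟙 (B y) * (ℓ * d)
    column y = begin
      ΣF (λ x → hits x y)
        ≡⟨ ΣF-swap (λ x i → 𝟙 (B y) * (tightness R L (flip c) y i * δ (c x y) (suc i))) ⟩
      ΣF (λ i → ΣF (λ x → 𝟙 (B y) * (tightness R L (flip c) y i * δ (c x y) (suc i))))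
        ≡⟨ ΣF-cong (λ i → trans (ΣF-*ˡ (𝟙 (B y)) (λ x → tightness R L (flip c) y i * δ (c x y) (suc i)))
                                (cong (𝟙 (B y) *_) (ΣF-*ˡ (tightness R L (flip c) y i) (λ x → δ (c x y) (suc i))))) ⟩
      ΣF (λ i → 𝟙 (B y) * (tightness R L (flip c) y i * degree (flip c) y i))
        ≡⟨ ΣF-*ˡ (𝟙 (B y)) (λ i → tightness R L (flip c) y i * degree (flip c) y i) ⟩
      𝟙 (B y) * ΣF (λ i → tightness R L (flip c) y i * degree (flip c) y i)
        ≤⟨ *-monoʳ-≤ (𝟙 (B y)) (tight-degrees R L (flip c) satR y) ⟩
      𝟙 (B y) * (ℓ * d) ∎
      where open ≤-Reasoning

    small : countF core′ ≤ core-bound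
    small = begin
      countF core′
        ≤⟨ ΣF-mono (λ x → ≤-trans (𝟙-∨ (A x) _) (+-monoʳ-≤ (𝟙 (A x)) (touched-hit x))) ⟩
      ΣF (λ x → 𝟙 (A x) + ΣF (hits x))
        ≡⟨ ΣF-+ (λ x → 𝟙 (A x)) (λ x → ΣF (hits x)) ⟩
      countF A + ΣF (λ x → ΣF (hits x))
        ≡⟨ cong (countF A +_) (ΣF-swap hits) ⟩
      countF A + ΣF (λ y → ΣF (λ x → hits x y))
        ≤⟨ +-mono-≤ A-small (ΣF-mono column) ⟩
      classes L * (ℓ * d) + ΣF (λ y → 𝟙 (B y) * (ℓ * d))
        ≡⟨ cong (classes L * (ℓ * d) +_) (ΣF-*ʳ (λ y → 𝟙 (B y)) (ℓ * d)) ⟩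
      classes L * (ℓ * d) + countF B * (ℓ * d)
        ≤⟨ +-monoʳ-≤ (classes L * (ℓ * d)) (*-monoˡ-≤ (ℓ * d) B-small) ⟩
      core-bound ∎
      where open ≤-Reasoning

record NormalForm {ℓ d : ℕ} (L R : Side ℓ d) (p q : ℕ) : Set where
  field
    c       : Graph L R
    A       : Fin (size L) → Bool
    B       : Fin (size R) → Bool
    A-small : countF A ≤ p
    B-small : countF B ≤ q
    satL    : Satisfies L R c
    satR    : Satisfies R L (flip c)
    tight   : Tight L R A B c

normalise : (L R : Side ℓ d) (c : Graph L R) → Satisfies L R c → Satisfies R L (flip c) →
            NormalForm L R (core-bound L R) (core-bound R L)
normalise {ℓ} {d} L R c satL satR
  with c , (satL , satR) , minimal ← minimise L R c (satL , satR)
  with A , A-few , A-plenty ← choose-per-class (ℓ * d) (class L)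
  with B , B-few , B-plenty ← choose-per-class (ℓ * d) (class R)
  with 𝒜 , refl , 𝒜-small , 𝒜-touch ← build-core L R c satR A A-few A-plenty B B-few
  with ℬ , refl , ℬ-small , ℬ-touch ← build-core R L (flip c) satL B B-few B-plenty A A-few
  with c′ , inv , tight ← tighten 𝒜 ℬ c (record
         { satL = satL ; satR = satR
         ; one-tight = λ _ _ e → minimal _ _ _ e
         -- A vertex outside the core is not tightly joined to the opposite reservoir, so the
         -- reservoir end has a surplus; minimality then forbids one at the other end.
         ; tight-left = λ x∉ y∈ e f → minimal _ _ _ e f (𝒜-touch x∉ y∈ e)
         ; tight-right = λ x∈ y∉ e → minimal _ _ _ e (ℬ-touch y∉ x∈ e) })
  = record { c = c′ ; A = core 𝒜 ; B = core ℬ ; A-small = 𝒜-small ; B-small = ℬ-small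
           ; satL = Invariant.satL inv ; satR = Invariant.satR inv ; tight = tight }

-- Eliminating colours with few edges outside the core

positive : ℕ → Bool
positive zero    = false
positive (suc _) = true

positive-true : 0 < n → positive n ≡ true
positive-true (s≤s _) = refl

positive-mono : m ≤ n → 𝟙 (positive m) ≤ 𝟙 (positive n)
positive-mono z≤n     = z≤n
positive-mono (s≤s _) = ≤-refl

module _ (B : Fin b → Bool) (c : Colouring a b ℓ) where

  -- `row (A x) x i` unfolds to the degree of `x` in `inner A B c`. Treating membership in `A` as a
  -- free Boolean permits case analysis when `A` grows.
  row : Bool → Fin a → Fin ℓ → ℕ
  row u x i = ΣF (λ y → δ (if u ∨ B y then zero else c x y) (suc i))

  total : (Fin a → Bool) → Fin ℓ → ℕ
  total A i = ΣF (λ x → degree (inner A B c) x i)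

  live : (Fin a → Bool) → ℕ
  live A = ΣF (λ i → 𝟙 (positive (total A i)))

  -- A colour with few inner edges is killed by adding their left ends to A.
  absorb : ∀ T n A → live A ≤ n → ∃ λ A⁺ → (∀ x → A x ≡ true → A⁺ x ≡ true) ×
           countF A⁺ ≤ countF A + n * T × (∀ i → total A⁺ i ≡ 0 ⊎ T ≤ total A⁺ i)
  absorb T n A live≤n with any? (λ i → (0 <? total A i) ×-dec (total A i <? T))
  ... | no none = A , (λ _ x∈ → x∈) , m≤m+n _ _ , dichotomy
    where
    dichotomy : ∀ i → total A i ≡ 0 ⊎ T ≤ total A i
    dichotomy i with total A i <? T
    ... | no  large = inj₂ (≮⇒≥ large)
    ... | yes small = inj₁ (n≤0⇒n≡0 (≮⇒≥ (λ pos → none (i , pos , small))))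
  absorb T zero A live≤0 | yes (i , pos , _) =
    contradiction (≤-trans (≤-reflexive (sym (cong 𝟙 (positive-true pos))))
                           (≤-trans (term≤ΣF (λ i → 𝟙 (positive (total A i))) i) live≤0)) λ ()
  absorb T (suc n) A live≤n | yes (i , pos , few) =
    let A⁺ , A′⊆A⁺ , A⁺-small , dichotomy = absorb T n A′ (≤-pred (≤-trans live-drops live≤n)) in
    A⁺ , (λ x x∈ → A′⊆A⁺ x (cong (_∨ positive (degree (inner A B c) x i)) x∈)) , bound A⁺-small , dichotomy
    where
    A′ : Fin a → Bool
    A′ x = A x ∨ positive (degree (inner A B c) x i)

    degree≤ : ∀ x j → degree (inner A′ B c) x j ≤ degree (inner A B c) x j
    degree≤ x j = row≤ (A x) _
      where
      row≤ : ∀ u v → row (u ∨ v) x j ≤ row u x j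
      row≤ true  v     = ≤-refl
      row≤ false false = ≤-refl
      row≤ false true  = ≤-trans (≤-reflexive (ΣF-0 b)) z≤n

    killed : ∀ x → degree (inner A′ B c) x i ≡ 0
    killed x = row-killed (A x)
      where
      row-killed : ∀ u → row (u ∨ positive (row u x i)) x i ≡ 0
      row-killed true  = ΣF-0 b
      row-killed false = cases (row false x i) refl
        where
        cases : ∀ n → row false x i ≡ n → row (positive n) x i ≡ 0
        cases zero    eq = eq
        cases (suc _) _  = ΣF-0 b

    -- Enlarging `A` only lowers the totals, so dead colours stay dead while colour `i` dies.
    live-drops : live A′ < live A
    live-drops = ΣF-mono-< mono i strictly
      where
      mono : ∀ j → 𝟙 (positive (total A′ j)) ≤ 𝟙 (positive (total A j))
      mono j = positive-mono (ΣF-mono (λ x → degree≤ x j))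
      strictly : 𝟙 (positive (total A′ i)) < 𝟙 (positive (total A i))
      strictly rewrite ΣF-zero killed | positive-true pos = ≤-refl

    grows : ∀ u n → 𝟙 (u ∨ positive n) ≤ 𝟙 u + n
    grows true  n       = m≤m+n 1 n
    grows false zero    = z≤n
    grows false (suc n) = s≤s z≤n

    -- Every added vertex carries at least one inner edge of colour `i`, and there are fewer than
    -- `T` such edges.
    bound : ∀ {N} → N ≤ countF A′ + n * T → N ≤ countF A + suc n * T
    bound {N} N≤ = begin
      N                                  ≤⟨ N≤ ⟩
      countF A′ + n * T                  ≤⟨ +-monoˡ-≤ (n * T) (ΣF-mono (λ x → grows (A x) _)) ⟩
      ΣF (λ x → 𝟙 (A x) + degree (inner A B c) x i) + n * T
                                         ≡⟨ cong (_+ n * T) (ΣF-+ (λ x → 𝟙 (A x)) _) ⟩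
      countF A + total A i + n * T       ≤⟨ +-monoˡ-≤ (n * T) (+-monoʳ-≤ (countF A) (<⇒≤ few)) ⟩
      countF A + T + n * T               ≡⟨ +-assoc (countF A) T (n * T) ⟩
      countF A + suc n * T               ∎
      where open ≤-Reasoning

-- Schemes

-- When `X` counts vertices by class and state, this is the sum of `g` over the states of all
-- vertices.
weigh : (Fin m → Fin p → ℕ) → (Fin p → ℕ) → ℕ
weigh X g = ΣF (λ j → ΣF (λ z → X j z * g z))

-- X j z is the number of left vertices of class j in state z, and Y is its analogue on the right.
-- Vertices in states z and w are joined by colour Col z w; on top of that, a vertex in state z
-- takes part in rL z i further edges of colour i.
record Solution {ℓ d m n p q : ℕ} (C : Fin m → Fin ℓ → 𝔹) (D : Fin n → Fin ℓ → 𝔹)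
                (Col : Fin p → Fin q → Fin (suc ℓ))
                (rL : Fin p → Fin ℓ → Fin (suc d)) (rR : Fin q → Fin ℓ → Fin (suc d))
                (M : Fin m → ℕ) (N : Fin n → ℕ)
                (X : Fin m → Fin p → ℕ) (Y : Fin n → Fin q → ℕ) : Set where
  field
    -- Further edges can join two states only where `Col` prescribes no edge, so the two kinds of
    -- edges never collide.
    compatible : ∀ z w i → toℕ (rL z i) ≡ 0 ⊎ toℕ (rR w i) ≡ 0 ⊎ toℕ (Col z w) ≡ 0
    sizeL      : ∀ j → ΣF (X j) ≡ M j
    sizeR      : ∀ k → ΣF (Y k) ≡ N k
    demandL    : ∀ j z → X j z ≡ 0 ⊎ (∀ i → (weigh Y (λ w → δ (Col z w) (suc i)) + toℕ (rL z i)) ≐ C j i)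
    demandR    : ∀ k w → Y k w ≡ 0 ⊎ (∀ i → (weigh X (λ z → δ (Col z w) (suc i)) + toℕ (rR w i)) ≐ D k i)
    balanced   : ∀ i → weigh X (λ z → toℕ (rL z i)) ≡ weigh Y (λ w → toℕ (rR w i))
    large      : ∀ i → weigh X (λ z → toℕ (rL z i)) ≡ 0 ⊎ threshold ℓ d ≤ weigh X (λ z → toℕ (rL z i))

-- A table of unknowns is stored as one flat vector, so that a single block of quantifiers can bind
-- it.
entry : (Fin (m * p) → ℕ) → Fin m → Fin p → ℕ
entry X j z = X (combine j z)

record Counts {a m p : ℕ} (cl : Fin a → Fin m) (st : Fin a → Fin p) (X : Fin m → Fin p → ℕ) : Set where
  constructor counting
  field
    counts : ∀ j z → X j z ≡ ΣF (λ x → δ (cl x) j * δ (st x) z)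

open Counts

-- The first vertex makes the total of its class positive, so some state `z₀` is available there. It
-- receives that state, one unit is subtracted from `X`, and the remaining vertices follow by
-- induction.
assign : (cl : Fin a → Fin m) (X : Fin m → Fin p → ℕ) →
         (∀ j → ΣF (X j) ≡ ΣF (λ x → δ (cl x) j)) → ∃ λ st → Counts cl st X
assign {zero}  cl X sizes = (λ ()) , counting λ j z → n≤0⇒n≡0 (≤-trans (term≤ΣF (X j) z) (≤-reflexive (sizes j)))
assign {suc a} cl X sizes
  with z₀ , pos ← 0<ΣF⇒∃ (X (cl zero))
         (≤-trans (≤-trans (≤-reflexive (sym (δ-refl (cl zero)))) (m≤m+n _ _)) (≤-reflexive (sym (sizes (cl zero)))))
  = (z₀ ∷ st) , counting λ j z → trans (sym (X′+ j z)) (trans (+-comm (X′ j z) _) (cong (hit j z +_) (counts rest j z)))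
  where
  hit : _ → _ → ℕ
  hit j z = δ (cl zero) j * δ z₀ z
  X′ : _ → _ → ℕ
  X′ j z = X j z ∸ hit j z
  X′+ : ∀ j z → X′ j z + hit j z ≡ X j z
  X′+ j z with δ*δ-cases (cl zero) j z₀ z
  ... | inj₁ (refl , refl , eq) rewrite eq = m∸n+n≡m pos
  ... | inj₂ eq rewrite eq = +-identityʳ _
  sizes′ : ∀ j → ΣF (X′ j) ≡ ΣF (λ x → δ (cl (suc x)) j)
  sizes′ j = +-cancelʳ-≡ (δ (cl zero) j) _ _ (begin
    ΣF (X′ j) + δ (cl zero) j            ≡⟨ cong (ΣF (X′ j) +_) (*-identityʳ (δ (cl zero) j)) ⟨
    ΣF (X′ j) + δ (cl zero) j * 1        ≡⟨ cong (λ s → ΣF (X′ j) + δ (cl zero) j * s) (ΣF-δ₁ z₀) ⟨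
    ΣF (X′ j) + δ (cl zero) j * ΣF (δ z₀) ≡⟨ cong (ΣF (X′ j) +_) (ΣF-*ˡ (δ (cl zero) j) (δ z₀)) ⟨
    ΣF (X′ j) + ΣF (hit j)               ≡⟨ ΣF-+ (X′ j) (hit j) ⟨
    ΣF (λ z → X′ j z + hit j z)          ≡⟨ ΣF-cong (X′+ j) ⟩
    ΣF (X j)                             ≡⟨ sizes j ⟩
    δ (cl zero) j + ΣF (λ x → δ (cl (suc x)) j) ≡⟨ +-comm (δ (cl zero) j) _ ⟩
    ΣF (λ x → δ (cl (suc x)) j) + δ (cl zero) j ∎)
    where open ≡-Reasoning
  st = proj₁ (assign (cl ∘ suc) X′ sizes′)
  rest = proj₂ (assign (cl ∘ suc) X′ sizes′)

module _ {cl : Fin a → Fin m} {st : Fin a → Fin p} {X : Fin m → Fin p → ℕ} (census : Counts cl st X) where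

  weigh-states : ∀ g → weigh X g ≡ ΣF (λ x → g (st x))
  weigh-states g = begin
    ΣF (λ j → ΣF (λ z → X j z * g z))
      ≡⟨ ΣF-cong (λ j → ΣF-cong (λ z → trans (cong (_* g z) (counts census j z))
           (trans (sym (ΣF-*ʳ (λ x → δ (cl x) j * δ (st x) z) (g z)))
                  (ΣF-cong (λ x → *-assoc (δ (cl x) j) (δ (st x) z) (g z)))))) ⟩
    ΣF (λ j → ΣF (λ z → ΣF (λ x → t x j z)))
      ≡⟨ ΣF-cong (λ j → ΣF-swap (λ z x → t x j z)) ⟩
    ΣF (λ j → ΣF (λ x → ΣF (t x j)))
      ≡⟨ ΣF-swap (λ j x → ΣF (t x j)) ⟩
    ΣF (λ x → ΣF (λ j → ΣF (t x j)))
      ≡⟨ ΣF-cong (λ x → ΣF-cong (λ j → trans (ΣF-*ˡ (δ (cl x) j) (λ z → δ (st x) z * g z))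
                                             (cong (δ (cl x) j *_) (ΣF-δ′ (st x) g)))) ⟩
    ΣF (λ x → ΣF (λ j → δ (cl x) j * g (st x)))
      ≡⟨ ΣF-cong (λ x → ΣF-δ′ (cl x) (λ _ → g (st x))) ⟩
    ΣF (λ x → g (st x)) ∎
    where
    open ≡-Reasoning
    t : Fin a → Fin m → Fin p → ℕ
    t x j z = δ (cl x) j * (δ (st x) z * g z)

  occupied : ∀ x → 0 < X (cl x) (st x)
  occupied x rewrite counts census (cl x) (st x) = ≤-trans
    (≤-reflexive (sym (cong₂ _*_ (δ-refl (cl x)) (δ-refl (st x)))))
    (term≤ΣF (λ x′ → δ (cl x′) (cl x) * δ (st x′) (st x)) x)

  occupied⇒∃ : ∀ {j z} → 0 < X j z → ∃ λ x → cl x ≡ j × st x ≡ z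
  occupied⇒∃ {j} {z} pos
    with x , hit ← 0<ΣF⇒∃ (λ x → δ (cl x) j * δ (st x) z) (subst (0 <_) (counts census j z) pos)
    with δ*δ-cases (cl x) j (st x) z
  ... | inj₁ (eq , eq′ , _) = x , eq , eq′
  ... | inj₂ miss = contradiction (subst (0 <_) miss hit) λ ()

  counts-size : ∀ j → ΣF (X j) ≡ ΣF (λ x → δ (cl x) j)
  counts-size j = begin
    ΣF (X j)                                        ≡⟨ ΣF-cong (counts census j) ⟩
    ΣF (λ z → ΣF (λ x → δ (cl x) j * δ (st x) z))   ≡⟨ ΣF-swap (λ z x → δ (cl x) j * δ (st x) z) ⟩
    ΣF (λ x → ΣF (λ z → δ (cl x) j * δ (st x) z))   ≡⟨ ΣF-cong (λ x → trans (ΣF-*ˡ (δ (cl x) j) (δ (st x)))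
                                                         (trans (cong (δ (cl x) j *_) (ΣF-δ₁ (st x))) (*-identityʳ _))) ⟩
    ΣF (λ x → δ (cl x) j)                           ∎
    where open ≡-Reasoning

tabulate-counts : (cl : Fin a → Fin m) (st : Fin a → Fin p) → ∃ λ X → Counts cl st (entry X)
tabulate-counts {m = m} {p} cl st =
  (λ i → let j , z = remQuot {m} p i in number j z) ,
  counting λ j z → cong (λ (j , z) → number j z) (remQuot-combine j z)
  where
  number : Fin m → Fin p → ℕ
  number j z = ΣF (λ x → δ (cl x) j * δ (st x) z)

merge : Fin (suc ℓ) → Fin (suc ℓ) → Fin (suc ℓ)
merge zero    e = e
merge (suc i) _ = suc i

degree-merge : (c₁ c₂ : Colouring a b ℓ) → (∀ x y → c₁ x y ≡ zero ⊎ c₂ x y ≡ zero) → ∀ x i →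
               degree (λ x y → merge (c₁ x y) (c₂ x y)) x i ≡ degree c₁ x i + degree c₂ x i
degree-merge c₁ c₂ exclusive x i =
  trans (ΣF-cong pointwise) (ΣF-+ (λ y → δ (c₁ x y) (suc i)) (λ y → δ (c₂ x y) (suc i)))
  where
  pointwise : ∀ y → δ (merge (c₁ x y) (c₂ x y)) (suc i) ≡ δ (c₁ x y) (suc i) + δ (c₂ x y) (suc i)
  pointwise y with c₁ x y | c₂ x y | exclusive x y
  ... | zero  | _    | _         = refl
  ... | suc _ | zero | _         = sym (+-identityʳ _)
  ... | suc _ | suc _ | inj₁ ()
  ... | suc _ | suc _ | inj₂ ()

Feasible : Side ℓ d → Side ℓ d → Set
Feasible L R = ∃ λ (c : Graph L R) → Satisfies L R c × Satisfies R L (flip c)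

population : (L : Side ℓ d) → Fin (classes L) → ℕ
population L j = ΣF (λ x → δ (class L x) j)

module _ {ℓ d p q : ℕ} (L R : Side ℓ d) {Col : Fin p → Fin q → Fin (suc ℓ)}
         {rL : Fin p → Fin ℓ → Fin (suc d)} {rR : Fin q → Fin ℓ → Fin (suc d)} where

  -- States are dealt out according to `X` and `Y`. `Col` then gives the recorded edges,
  -- `Realisation` supplies a graph with the residual degrees, and the two are merged.
  solution⇒feasible : ∀ {M N X Y} → (∀ j → M j ≡ population L j) → (∀ k → N k ≡ population R k) →
                      Solution (demand L) (demand R) Col rL rR M N X Y → Feasible L R
  solution⇒feasible {M} {N} {X} {Y} M≡ N≡ sol
    with st  , countsL ← assign (class L) X (λ j → trans (Solution.sizeL sol j) (M≡ j))
    with st′ , countsR ← assign (class R) Y (λ k → trans (Solution.sizeR sol k) (N≡ k))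
    = c , satL , satR
    where
    open Solution sol
    r : Fin (size L) → Fin ℓ → ℕ
    r x i = toℕ (rL (st x) i)
    r′ : Fin (size R) → Fin ℓ → ℕ
    r′ y i = toℕ (rR (st′ y) i)
    sumL : ∀ i → weigh X (λ z → toℕ (rL z i)) ≡ ΣF (λ x → r x i)
    sumL i = weigh-states countsL (λ z → toℕ (rL z i))
    sumR : ∀ i → weigh Y (λ w → toℕ (rR w i)) ≡ ΣF (λ y → r′ y i)
    sumR i = weigh-states countsR (λ w → toℕ (rR w i))
    module Inner = Realisation {d = d} r r′
      (λ x i → ≤-pred (toℕ<n (rL (st x) i))) (λ y i → ≤-pred (toℕ<n (rR (st′ y) i)))
      (λ i → trans (sym (sumL i)) (trans (balanced i) (sumR i)))
      (λ i → subst (λ s → s ≡ 0 ⊎ threshold ℓ d ≤ s) (sumL i) (large i))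
    c₁ c₂ c : Graph L R
    c₁ x y = Col (st x) (st′ y)
    c₂ = proj₁ Inner.realise
    c x y = merge (c₁ x y) (c₂ x y)
    degL : ∀ x i → degree c₂ x i ≡ r x i
    degL = proj₁ (proj₂ Inner.realise)
    degR : ∀ y i → degree (flip c₂) y i ≡ r′ y i
    degR = proj₂ (proj₂ Inner.realise)

    -- An edge of `c₂` makes both residual degrees in its colour positive, which leaves only the
    -- last alternative of `compatible`.
    exclusive : ∀ x y → c₁ x y ≡ zero ⊎ c₂ x y ≡ zero
    exclusive x y with c₂ x y in e
    ... | zero  = inj₂ refl
    ... | suc i with compatible (st x) (st′ y) i
    ...   | inj₁ none        = contradiction (trans (degL x i) none) (>⇒≢ (0<degree c₂ e))
    ...   | inj₂ (inj₁ none) = contradiction (trans (degR y i) none) (>⇒≢ (0<degree (flip c₂) e))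
    ...   | inj₂ (inj₂ none) = inj₁ (toℕ-injective none)

    satL : Satisfies L R c
    satL x i with demandL (class L x) (st x)
    ... | inj₁ empty = contradiction empty (>⇒≢ (occupied countsL x))
    ... | inj₂ ok = subst (_≐ required L x i)
      (trans (cong₂ _+_ (weigh-states countsR (λ w → δ (Col (st x) w) (suc i))) (sym (degL x i)))
             (sym (degree-merge c₁ c₂ exclusive x i))) (ok i)

    satR : Satisfies R L (flip c)
    satR y i with demandR (class R y) (st′ y)
    ... | inj₁ empty = contradiction empty (>⇒≢ (occupied countsR y))
    ... | inj₂ ok = subst (_≐ required R y i)
      (trans (cong₂ _+_ (weigh-states countsL (λ z → δ (Col z (st′ y)) (suc i))) (sym (degR y i)))
             (sym (degree-merge (flip c₁) (flip c₂) (λ y x → exclusive x y) y i))) (ok i)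

  -- Sums over vertices become weighted sums over states. An occupied pair of class and state
  -- contains a vertex, and the demand holds for the pair because it holds there.
  states⇒solution : ∀ {st st′ X Y} → Counts (class L) st X → Counts (class R) st′ Y →
    (∀ z w i → toℕ (rL z i) ≡ 0 ⊎ toℕ (rR w i) ≡ 0 ⊎ toℕ (Col z w) ≡ 0) →
    (∀ x i → (degree (λ x y → Col (st x) (st′ y)) x i + toℕ (rL (st x) i)) ≐ required L x i) →
    (∀ y i → (degree (λ y x → Col (st x) (st′ y)) y i + toℕ (rR (st′ y) i)) ≐ required R y i) →
    (∀ i → ΣF (λ x → toℕ (rL (st x) i)) ≡ ΣF (λ y → toℕ (rR (st′ y) i))) →
    (∀ i → ΣF (λ x → toℕ (rL (st x) i)) ≡ 0 ⊎ threshold ℓ d ≤ ΣF (λ x → toℕ (rL (st x) i))) →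
    Solution (demand L) (demand R) Col rL rR (population L) (population R) X Y
  states⇒solution {st} {st′} {X} {Y} countsL countsR compatible okL okR balanced large = record
    { compatible = compatible
    ; sizeL = counts-size countsL
    ; sizeR = counts-size countsR
    ; demandL = demandL
    ; demandR = demandR
    ; balanced = λ i → trans (sumL i) (trans (balanced i) (sym (weigh-states countsR (λ w → toℕ (rR w i)))))
    ; large = λ i → subst (λ s → s ≡ 0 ⊎ threshold ℓ d ≤ s) (sym (sumL i)) (large i)
    }
    where
    sumL : ∀ i → weigh X (λ z → toℕ (rL z i)) ≡ ΣF (λ x → toℕ (rL (st x) i))
    sumL i = weigh-states countsL (λ z → toℕ (rL z i))

    demandL : ∀ j z → X j z ≡ 0 ⊎ (∀ i → (weigh Y (λ w → δ (Col z w) (suc i)) + toℕ (rL z i)) ≐ demand L j i)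
    demandL j z with 0 <? X j z
    ... | no  none = inj₁ (n≤0⇒n≡0 (≮⇒≥ none))
    ... | yes some with x , refl , refl ← occupied⇒∃ countsL {j} {z} some = inj₂ λ i →
      subst (_≐ required L x i) (cong (_+ toℕ (rL (st x) i)) (sym (weigh-states countsR (λ w → δ (Col (st x) w) (suc i))))) (okL x i)

    demandR : ∀ k w → Y k w ≡ 0 ⊎ (∀ i → (weigh X (λ z → δ (Col z w) (suc i)) + toℕ (rR w i)) ≐ demand R k i)
    demandR k w with 0 <? Y k w
    ... | no  none = inj₁ (n≤0⇒n≡0 (≮⇒≥ none))
    ... | yes some with y , refl , refl ← occupied⇒∃ countsR {k} {w} some = inj₂ λ i →
      subst (_≐ required R y i) (cong (_+ toℕ (rR (st′ y) i)) (sym (weigh-states countsL (λ z → δ (Col z (st′ y)) (suc i))))) (okR y i)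

-- Finite encoding of vertex states

matrix : Fin ((k ^ q) ^ p) → Fin p → Fin q → Fin k
matrix κ z = finToFun (finToFun κ z)

-- Hence the choice of `Col`, `rL` and `rR` is a choice of numbers below a fixed bound, that is, a
-- finite disjunction.
matrix-surjective : (f : Fin p → Fin q → Fin k) → ∃ λ κ → ∀ z w → matrix {k} {q} {p} κ z w ≡ f z w
matrix-surjective f = funToFin (λ z → funToFin (f z)) , λ z w →
  trans (cong (λ κ → finToFun κ w) (finToFun-funToFin (λ z → funToFin (f z)) z))
        (finToFun-funToFin (f z) w)

-- There is one state for every core vertex of the own side (p of them), and one for every pair of
-- a profile, which lists the colours of the edges to the q core vertices of the other side, and
-- a residue.
stateCount : (ℓ d p q : ℕ) → ℕ
stateCount ℓ d p q = p + suc ℓ ^ q * suc d ^ ℓ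

State : (ℓ d p q : ℕ) → Set
State ℓ d p q = Fin p ⊎ ((Fin q → Fin (suc ℓ)) × (Fin ℓ → Fin (suc d)))

decodePair : Fin (suc ℓ ^ q) × Fin (suc d ^ ℓ) → State ℓ d p q
decodePair (κ , κ′) = inj₂ (finToFun κ , finToFun κ′)

decode : Fin (stateCount ℓ d p q) → State ℓ d p q
decode {ℓ} {d} {p} {q} z = [ inj₁ , decodePair ∘ remQuot {suc ℓ ^ q} (suc d ^ ℓ) ]′ (splitAt p z)

decode-↑ˡ : ∀ e → decode {ℓ} {d} {p} {q} (e ↑ˡ _) ≡ inj₁ e
decode-↑ˡ {ℓ} {d} {p} {q} e = cong [ inj₁ , _ ]′ (splitAt-↑ˡ p e (suc ℓ ^ q * suc d ^ ℓ))

decode-↑ʳ : ∀ κ κ′ → decode {ℓ} {d} {p} {q} (p ↑ʳ combine κ κ′) ≡ inj₂ (finToFun κ , finToFun κ′)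
decode-↑ʳ {ℓ} {d} {p} {q} κ κ′ =
  trans (cong [ inj₁ , _ ]′ (splitAt-↑ʳ p (suc ℓ ^ q * suc d ^ ℓ) (combine κ κ′)))
        (cong decodePair (remQuot-combine {suc ℓ ^ q} {suc d ^ ℓ} κ κ′))

-- All edges at a core vertex are recorded by colours, so nothing remains there.
residue : State ℓ d p q → Fin ℓ → Fin (suc d)
residue (inj₁ _)       i = zero
residue (inj₂ (_ , r)) i = r i

enumerate : (A : Fin a → Bool) → ∃ λ (e : Fin (countF A) → Fin a) → ∀ x → A x ≡ true → ∃ λ i → e i ≡ x
enumerate {zero}  A = (λ ()) , λ ()
enumerate {suc a} A with A zero in A0 | enumerate (A ∘ suc)
... | true  | e , onto = (zero ∷ (suc ∘ e)) , λ
  { zero    _  → zero , refl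
  ; (suc x) x∈ → let i , eq = onto x x∈ in suc i , cong suc eq }
... | false | e , onto = (suc ∘ e) , λ
  { zero    x∈ → contradiction (trans (sym A0) x∈) λ ()
  ; (suc x) x∈ → let i , eq = onto x x∈ in i , cong suc eq }

module _ {a ℓ d p q : ℕ} (A : Fin a → Bool) (core-vertex : Fin p → Fin a)
         (profile : Fin a → Fin q → Fin (suc ℓ)) (res : Fin a → Fin ℓ → ℕ) where

  data View (x : Fin a) : State ℓ d p q → Set where
    named   : ∀ e → A x ≡ true → core-vertex e ≡ x → View x (inj₁ e)
    generic : ∀ {π r} → A x ≡ false → (∀ f → π f ≡ profile x f) → (∀ i → toℕ (r i) ≡ res x i) →
              View x (inj₂ (π , r))

  view : (∀ x → A x ≡ true → ∃ λ e → core-vertex e ≡ x) → (∀ x i → res x i ≤ d) →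
         ∀ x → ∃ λ z → View x (decode {ℓ} {d} {p} {q} z)
  view onto res≤d x with A x in x∈
  ... | true with e , eq ← onto x x∈ = e ↑ˡ _ , subst (View x) (sym (decode-↑ˡ e)) (named e x∈ eq)
  view onto res≤d x | false = p ↑ʳ combine (funToFin (profile x)) (funToFin r) ,
    subst (View x) (sym (decode-↑ʳ (funToFin (profile x)) (funToFin r)))
      (generic x∈ (finToFun-funToFin (profile x))
        (λ i → trans (cong toℕ (finToFun-funToFin r i)) (toℕ-fromℕ< (s≤s (res≤d x i)))))
    where
    r : Fin ℓ → Fin (suc d)
    r i = fromℕ< (s≤s (res≤d x i))

-- A positive inner degree comes from an inner edge of colour `i` at `x`. That edge is tight at `x`,
-- so even the full degree of `x` in this colour is at most `d`.
inner≤d : (L R : Side ℓ d) (A : Fin (size L) → Bool) (B : Fin (size R) → Bool) (c : Graph L R) →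
          Satisfies L R c → (∀ {x y i} → A x ≡ false → B y ≡ false → c x y ≡ suc i → ¬ Excess L R c x i) →
          ∀ x i → degree (inner A B c) x i ≤ d
inner≤d L R A B c sat tight x i with 0 <? degree (inner A B c) x i
... | no none = ≤-trans (≮⇒≥ none) z≤n
... | yes some
  with y , hit ← 0<ΣF⇒∃ (λ y → δ (inner A B c x y) (suc i)) some
  with x∉ , y∉ , e ← inner-edge A B c {x} {y} (0<δ⇒≡ hit)
  = ≤-trans (ΣF-mono (λ y → inner-δ≤ A B c x y i)) (tight⇒≤d L R c sat (tight x∉ y∉ e))

-- `p` and `q` are the sizes of the left and right cores. They swap roles in the state count of the
-- right side, whose profiles list the left core.
Solvable : (C : Fin m → Fin ℓ → 𝔹) (D : Fin n → Fin ℓ → 𝔹) (d p q : ℕ) → (Fin m → ℕ) → (Fin n → ℕ) → Set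
Solvable {ℓ = ℓ} C D d p q M N =
  ∃ λ κ → ∃ λ κL → ∃ λ κR → ∃ λ X → ∃ λ Y →
  Solution C D (matrix {suc ℓ} {stateCount ℓ d q p} {stateCount ℓ d p q} κ)
    (matrix {suc d} {ℓ} {stateCount ℓ d p q} κL) (matrix {suc d} {ℓ} {stateCount ℓ d q p} κR) M N (entry X) (entry Y)

solvable-cong : ∀ p q {C : Fin m → Fin ℓ → 𝔹} {D : Fin n → Fin ℓ → 𝔹} {M M′ N N′} →
  (∀ j → M j ≡ M′ j) → (∀ k → N k ≡ N′ k) → Solvable C D d p q M N → Solvable C D d p q M′ N′
solvable-cong p q M≡ N≡ (κ , κL , κR , X , Y , sol) = κ , κL , κR , X , Y , record
  { Solution sol
  ; sizeL = λ j → trans (Solution.sizeL sol j) (M≡ j)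
  ; sizeR = λ k → trans (Solution.sizeR sol k) (N≡ k) }

module _ {ℓ d : ℕ} (L R : Side ℓ d) (A : Fin (size L) → Bool) (B : Fin (size R) → Bool) (c : Graph L R)
         (satL : Satisfies L R c) (satR : Satisfies R L (flip c)) (tight : Tight L R A B c)
         (large : ∀ i → total B c A i ≡ 0 ⊎ threshold ℓ d ≤ total B c A i) where

  private
    p₀ = countF A
    q₀ = countF B
    vertexL = proj₁ (enumerate A)
    vertexR = proj₁ (enumerate B)

  stateL : ∀ x → ∃ λ z → View {d = d} A vertexL (λ x f → c x (vertexR f)) (degree (inner A B c)) x (decode {ℓ} {d} {p₀} {q₀} z)
  stateL = view A vertexL _ _ (proj₂ (enumerate A))
    (inner≤d L R A B c satL (λ x∉ y∉ e → proj₁ (tight x∉ y∉ e)))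

  stateR : ∀ y → ∃ λ w → View {d = d} B vertexR (λ y e → c (vertexL e) y) (degree (inner B A (flip c))) y (decode {ℓ} {d} {q₀} {p₀} w)
  stateR = view B vertexR _ _ (proj₂ (enumerate B))
    (inner≤d R L B A (flip c) satR (λ y∉ x∉ e → proj₂ (tight x∉ y∉ e)))

  -- Two generic states get no recorded edge: edges between such vertices are exactly the inner
  -- ones, present only through residues.
  colour : State ℓ d p₀ q₀ → State ℓ d q₀ p₀ → Fin (suc ℓ)
  colour (inj₁ e)       (inj₁ f)       = c (vertexL e) (vertexR f)
  colour (inj₁ e)       (inj₂ (π , _)) = π e
  colour (inj₂ (π , _)) (inj₁ f)       = π f
  colour (inj₂ _)       (inj₂ _)       = zero

  colour-states : ∀ x y → colour (decode (proj₁ (stateL x))) (decode (proj₁ (stateR y))) ≡ outer A B c x y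
  colour-states x y with decode {ℓ} {d} {p₀} {q₀} (proj₁ (stateL x)) | proj₂ (stateL x)
                       | decode {ℓ} {d} {q₀} {p₀} (proj₁ (stateR y)) | proj₂ (stateR y)
  ... | _ | named e x∈ refl    | _ | named f y∈ refl rewrite x∈ = refl
  ... | _ | named e x∈ refl    | _ | generic y∉ π≡ _ rewrite x∈ = π≡ e
  ... | _ | generic x∉ π≡ _    | _ | named f y∈ refl rewrite x∉ | y∈ = π≡ f
  ... | _ | generic x∉ _ _     | _ | generic y∉ _ _  rewrite x∉ | y∉ = refl

  residueL : ∀ x i → toℕ (residue (decode {ℓ} {d} {p₀} {q₀} (proj₁ (stateL x))) i) ≡ degree (inner A B c) x i
  residueL x i with decode {ℓ} {d} {p₀} {q₀} (proj₁ (stateL x)) | proj₂ (stateL x)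
  ... | _ | named e x∈ refl rewrite x∈ = sym (ΣF-0 (size R))
  ... | _ | generic _ _ r≡ = r≡ i

  residueR : ∀ y i → toℕ (residue (decode {ℓ} {d} {q₀} {p₀} (proj₁ (stateR y))) i) ≡ degree (inner B A (flip c)) y i
  residueR y i with decode {ℓ} {d} {q₀} {p₀} (proj₁ (stateR y)) | proj₂ (stateR y)
  ... | _ | named f y∈ refl rewrite y∈ = sym (ΣF-0 (size L))
  ... | _ | generic _ _ r≡ = r≡ i

  compatible-states : ∀ z w i → toℕ (residue z i) ≡ 0 ⊎ toℕ (residue w i) ≡ 0 ⊎ toℕ (colour z w) ≡ 0
  compatible-states (inj₁ _) w        i = inj₁ refl
  compatible-states (inj₂ _) (inj₁ _) i = inj₂ (inj₁ refl)
  compatible-states (inj₂ _) (inj₂ _) i = inj₂ (inj₂ refl)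

  -- The counts of the actual states form a solution: `outer` plus `inner` degrees give the demands,
  -- and the handshake identity for `inner` gives the balance.
  normal⇒solvable : Solvable (demand L) (demand R) d p₀ q₀ (population L) (population R)
  normal⇒solvable
    with κ  , κ≡  ← matrix-surjective (λ z w → colour (decode z) (decode w))
    with κL , κL≡ ← matrix-surjective (λ z → residue (decode {ℓ} {d} {p₀} {q₀} z))
    with κR , κR≡ ← matrix-surjective (λ w → residue (decode {ℓ} {d} {q₀} {p₀} w))
    with X , countsL ← tabulate-counts (class L) (λ x → proj₁ (stateL x))
    with Y , countsR ← tabulate-counts (class R) (λ y → proj₁ (stateR y))
    = κ , κL , κR , X , Y , states⇒solution L R countsL countsR compatible okL okR
        (λ i → trans (ΣF-cong (λ x → resL x i)) (trans (handshake (inner A B c) i)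
          (ΣF-cong (λ y → trans (degree-cong (λ y x → proj₁ (inner-outer-flip A B c x y)) y i) (sym (resR y i))))))
        (λ i → subst (λ s → s ≡ 0 ⊎ threshold ℓ d ≤ s) (sym (ΣF-cong (λ x → resL x i))) (large i))
    where
    resL : ∀ x i → toℕ (matrix κL (proj₁ (stateL x)) i) ≡ degree (inner A B c) x i
    resL x i = trans (cong toℕ (κL≡ _ i)) (residueL x i)
    resR : ∀ y i → toℕ (matrix κR (proj₁ (stateR y)) i) ≡ degree (inner B A (flip c)) y i
    resR y i = trans (cong toℕ (κR≡ _ i)) (residueR y i)
    col : ∀ x y → matrix κ (proj₁ (stateL x)) (proj₁ (stateR y)) ≡ outer A B c x y
    col x y = trans (κ≡ _ _) (colour-states x y)
    compatible : ∀ z w i → toℕ (matrix κL z i) ≡ 0 ⊎ toℕ (matrix κR w i) ≡ 0 ⊎ toℕ (matrix κ z w) ≡ 0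
    compatible z w i rewrite κL≡ z i | κR≡ w i | κ≡ z w = compatible-states (decode z) (decode w) i
    okL : ∀ x i → (degree (λ x y → matrix κ (proj₁ (stateL x)) (proj₁ (stateR y))) x i
                   + toℕ (matrix κL (proj₁ (stateL x)) i)) ≐ required L x i
    okL x i = subst (_≐ required L x i) (sym (trans (cong₂ _+_ (degree-cong col x i) (resL x i))
                (outer+inner A B c x i))) (satL x i)
    okR : ∀ y i → (degree (λ y x → matrix κ (proj₁ (stateL x)) (proj₁ (stateR y))) y i
                   + toℕ (matrix κR (proj₁ (stateR y)) i)) ≐ required R y i
    okR y i = subst (_≐ required R y i) (sym (trans (cong₂ _+_
                  (degree-cong (λ y x → trans (col x y) (proj₂ (inner-outer-flip A B c x y))) y i) (resR y i))
                (outer+inner B A (flip c) y i))) (satR y i)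

-- `core-bound` for each side. Only the left core is enlarged by `absorb`, at most `ℓ` times by at
-- most the threshold, which explains the asymmetry.
boundL boundR : (ℓ d m n : ℕ) → ℕ
boundL ℓ d m n = (m * (ℓ * d) + n * (ℓ * d) * (ℓ * d)) + ℓ * threshold ℓ d
boundR ℓ d m n = n * (ℓ * d) + m * (ℓ * d) * (ℓ * d)

live≤ℓ : (B : Fin b → Bool) (c : Colouring a b ℓ) (A : Fin a → Bool) → live B c A ≤ ℓ
live≤ℓ {ℓ = ℓ} B c A =
  ≤-trans (ΣF-≤-* (λ i → 𝟙≤1 (positive (total B c A i)))) (≤-reflexive (*-identityʳ ℓ))

normal-form⇒solvable : (L R : Side ℓ d) → NormalForm L R p q →
  ∃ λ p′ → ∃ λ q′ → p′ ≤ p + ℓ * threshold ℓ d × q′ ≤ q ×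
  Solvable (demand L) (demand R) d p′ q′ (population L) (population R)
normal-form⇒solvable {ℓ} {d} L R nf
  with A⁺ , A⊆A⁺ , A⁺-small , large ← absorb (NormalForm.B nf) (NormalForm.c nf) (threshold ℓ d) ℓ
         (NormalForm.A nf) (live≤ℓ (NormalForm.B nf) (NormalForm.c nf) (NormalForm.A nf))
  = countF A⁺ , countF B , ≤-trans A⁺-small (+-monoˡ-≤ (ℓ * threshold ℓ d) A-small) , B-small ,
    -- Enlarging the core leaves fewer edges on which tightness is asserted, so it is inherited.
    normal⇒solvable L R A⁺ B c satL satR (λ {x} x∉ → tight (not-in (A⊆A⁺ x) x∉)) large
  where
  open NormalForm nf
  not-in : ∀ {u v : Bool} → (u ≡ true → v ≡ true) → v ≡ false → u ≡ false
  not-in {false} _   _    = refl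
  not-in {true}  u⇒v refl with () ← u⇒v refl

feasible⇒solvable : (L R : Side ℓ d) → Feasible L R →
  ∃ λ p → ∃ λ q → p ≤ boundL ℓ d (classes L) (classes R) × q ≤ boundR ℓ d (classes L) (classes R) ×
  Solvable (demand L) (demand R) d p q (population L) (population R)
feasible⇒solvable L R (c , satL , satR) = normal-form⇒solvable L R (normalise L R c satL satR)

-- Definability in Presburger arithmetic

module _ {Γ : Set} {k : ℕ} (env : Γ → Vector ℕ k) where

  -- `Γ` is the type of parameters, and `env` reads off the values of the `k` free variables from
  -- them.
  record Affine (h : Γ → ℕ) : Set where
    field
      term : Term k
      eval : ∀ γ → evalT (env γ) term ≡ h γ

  record Definable (Q : Γ → Set) : Set where
    field
      formula  : Formula k
      sound    : ∀ γ → ⟦ formula ⟧ (env γ) → Q γ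
      complete : ∀ γ → Q γ → ⟦ formula ⟧ (env γ)

open Affine
open Definable

module _ {Γ : Set} {k : ℕ} {env : Γ → Vector ℕ k} where

  private variable
    h h′ : Γ → ℕ
    Q Q′ : Γ → Set

  const-affine : ∀ c → Affine env (λ _ → c)
  const-affine zero    = record { term = zer ; eval = λ _ → refl }
  const-affine (suc c) = record
    { term = one ⊕ term (const-affine c) ; eval = λ γ → cong suc (eval (const-affine c) γ) }

  +-affine : Affine env h → Affine env h′ → Affine env (λ γ → h γ + h′ γ)
  +-affine t t′ = record { term = term t ⊕ term t′ ; eval = λ γ → cong₂ _+_ (eval t γ) (eval t′ γ) }

  *-affine : Affine env h → ∀ c → Affine env (λ γ → h γ * c)
  *-affine {h} t zero    = record { term = zer ; eval = λ γ → sym (*-zeroʳ (h γ)) }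
  *-affine {h} t (suc c) = record
    { term = term t ⊕ term (*-affine t c)
    ; eval = λ γ → trans (cong₂ _+_ (eval t γ) (eval (*-affine t c) γ)) (sym (*-suc (h γ) c)) }

  Σ-affine : ∀ {l} {H : Γ → Fin l → ℕ} → (∀ j → Affine env (λ γ → H γ j)) → Affine env (λ γ → ΣF (H γ))
  Σ-affine {zero}  t = const-affine 0
  Σ-affine {suc l} {H} t = +-affine (t zero) (Σ-affine {H = λ γ → H γ ∘ suc} (t ∘ suc))

  ≡-definable : Affine env h → Affine env h′ → Definable env (λ γ → h γ ≡ h′ γ)
  ≡-definable t t′ = record
    { formula  = term t ≡ₜ term t′
    ; sound    = λ γ → subst₂ _≡_ (eval t γ) (eval t′ γ)
    ; complete = λ γ → subst₂ _≡_ (sym (eval t γ)) (sym (eval t′ γ)) }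

  ≤-definable : Affine env h → Affine env h′ → Definable env (λ γ → h γ ≤ h′ γ)
  ≤-definable t t′ = record
    { formula  = term t ≤ₜ term t′
    ; sound    = λ γ → subst₂ _≤_ (eval t γ) (eval t′ γ)
    ; complete = λ γ → subst₂ _≤_ (sym (eval t γ)) (sym (eval t′ γ)) }

  ≐-definable : Affine env h → ∀ β → Definable env (λ γ → h γ ≐ β)
  ≐-definable t (exactly e) = ≡-definable t (const-affine e)
  ≐-definable t (atLeast e) = ≤-definable (const-affine e) t

  ×-definable : Definable env Q → Definable env Q′ → Definable env (λ γ → Q γ × Q′ γ)
  ×-definable φ ψ = record
    { formula  = formula φ ∧ₚ formula ψ
    ; sound    = λ γ (u , v) → sound φ γ u , sound ψ γ v
    ; complete = λ γ (u , v) → complete φ γ u , complete ψ γ v }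

  ⊎-definable : Definable env Q → Definable env Q′ → Definable env (λ γ → Q γ ⊎ Q′ γ)
  ⊎-definable φ ψ = record
    { formula  = formula φ ∨ₚ formula ψ
    ; sound    = λ γ → [ (λ u → inj₁ (sound φ γ u)) , (λ v → inj₂ (sound ψ γ v)) ]′
    ; complete = λ γ → [ (λ u → inj₁ (complete φ γ u)) , (λ v → inj₂ (complete ψ γ v)) ]′ }

  map-definable : (∀ γ → Q γ → Q′ γ) → (∀ γ → Q′ γ → Q γ) → Definable env Q → Definable env Q′
  map-definable f g φ = record
    { formula  = formula φ
    ; sound    = λ γ u → f γ (sound φ γ u)
    ; complete = λ γ u → complete φ γ (g γ u) }

  ∀-definable : ∀ {l} {Q : Fin l → Γ → Set} → (∀ j → Definable env (Q j)) → Definable env (λ γ → ∀ j → Q j γ)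
  -- The empty conjunction is rendered as `0 = 0`.
  ∀-definable {zero}  φ = map-definable (λ _ _ ()) (λ _ _ → refl) (≡-definable (const-affine 0) (const-affine 0))
  ∀-definable {suc l} φ = map-definable
    (λ { γ (u , v) zero → u ; γ (u , v) (suc j) → v j }) (λ γ u → u zero , u ∘ suc)
    (×-definable (φ zero) (∀-definable (φ ∘ suc)))

  ∃-definable : ∀ {l} {Q : Fin l → Γ → Set} → (∀ j → Definable env (Q j)) → Definable env (λ γ → ∃ λ j → Q j γ)
  ∃-definable {zero}  φ = record { formula = ⊥ₚ ; sound = λ _ () ; complete = λ { _ (() , _) } }
  ∃-definable {suc l} φ = map-definable
    (λ γ → [ (λ u → zero , u) , (λ (j , u) → suc j , u) ]′)
    (λ { γ (zero , u) → inj₁ u ; γ (suc j , u) → inj₂ (j , u) })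
    (⊎-definable (φ zero) (∃-definable (φ ∘ suc)))

  -- A finite disjunction rather than a quantifier, because the formula for `Q j`, and even its
  -- number of bound variables, may vary with `j`.
  ∃≤-definable : ∀ l {Q : ℕ → Γ → Set} → (∀ j → Definable env (Q j)) →
                 Definable env (λ γ → ∃ λ j → j ≤ l × Q j γ)
  ∃≤-definable l {Q} φ = map-definable
    (λ γ (j , u) → toℕ j , ≤-pred (toℕ<n j) , u)
    (λ γ (j , j≤l , u) → fromℕ< (s≤s j≤l) , subst (λ j → Q j γ) (sym (toℕ-fromℕ< (s≤s j≤l))) u)
    (∃-definable {suc l} (λ j → φ (toℕ j)))

extendAll : Vector ℕ p → Vector ℕ k → Vector ℕ (p + k)
extendAll {zero}  x ρ = ρ
extendAll {suc p} x ρ = extend (x zero) (extendAll (x ∘ suc) ρ)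

extendAll-↑ˡ : (x : Vector ℕ p) (ρ : Vector ℕ k) → ∀ i → extendAll x ρ (i ↑ˡ k) ≡ x i
extendAll-↑ˡ x ρ zero    = refl
extendAll-↑ˡ x ρ (suc i) = extendAll-↑ˡ (x ∘ suc) ρ i

extendAll-↑ʳ : ∀ {p} (x : Vector ℕ p) (ρ : Vector ℕ k) → ∀ i → extendAll x ρ (p ↑ʳ i) ≡ ρ i
extendAll-↑ʳ {p = zero}  x ρ i = refl
extendAll-↑ʳ {p = suc p} x ρ i = extendAll-↑ʳ (x ∘ suc) ρ i

-- Renaming terms suffices: parameters are weakened as affine functions, before any formula is
-- formed.
rename : (Fin k → Fin l) → Term k → Term l
rename σ (var i) = var (σ i)
rename σ zer     = zer
rename σ one     = one
rename σ (t ⊕ u) = rename σ t ⊕ rename σ u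

eval-rename : (σ : Fin k → Fin l) {ρ : Vector ℕ k} {ρ′ : Vector ℕ l} → (∀ i → ρ′ (σ i) ≡ ρ i) →
              ∀ t → evalT ρ′ (rename σ t) ≡ evalT ρ t
eval-rename σ eq (var i) = eq i
eval-rename σ eq zer     = refl
eval-rename σ eq one     = refl
eval-rename σ eq (t ⊕ u) = cong₂ _+_ (eval-rename σ eq t) (eval-rename σ eq u)

-- The innermost quantifier binds variable 0, in agreement with `extendAll`, which puts `x zero` in
-- front.
∃ⁿ : ∀ p → Formula (p + k) → Formula k
∃ⁿ zero    φ = φ
∃ⁿ (suc p) φ = ∃ⁿ p (∃ₚ φ)

∃ⁿ-sound : ∀ p (φ : Formula (p + k)) {ρ} → ⟦ ∃ⁿ p φ ⟧ ρ → ∃ λ x → ⟦ φ ⟧ (extendAll x ρ)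
∃ⁿ-sound zero    φ u = (λ ()) , u
∃ⁿ-sound (suc p) φ u with x , v , w ← ∃ⁿ-sound p (∃ₚ φ) u = (v ∷ x) , w

∃ⁿ-complete : ∀ p (φ : Formula (p + k)) {ρ} x → ⟦ φ ⟧ (extendAll x ρ) → ⟦ ∃ⁿ p φ ⟧ ρ
∃ⁿ-complete zero    φ x u = u
∃ⁿ-complete (suc p) φ x u = ∃ⁿ-complete p (∃ₚ φ) (x ∘ suc) (x zero , u)

module _ {Γ : Set} {k : ℕ} (env : Γ → Vector ℕ k) (m p : ℕ) where

  blockEnv : (Fin (m * p) → ℕ) × Γ → Vector ℕ (m * p + k)
  blockEnv (x , γ) = extendAll x (env γ)

  entry-affine : ∀ j z → Affine blockEnv (λ (x , _) → entry {m} {p} x j z)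
  entry-affine j z = record
    { term = var (combine j z ↑ˡ k) ; eval = λ (x , γ) → extendAll-↑ˡ x (env γ) (combine j z) }

  weaken-affine : ∀ {h} → Affine env h → Affine blockEnv (λ (_ , γ) → h γ)
  weaken-affine t = record
    { term = rename (m * p ↑ʳ_) (term t)
    ; eval = λ (x , γ) → trans (eval-rename (m * p ↑ʳ_) (extendAll-↑ʳ x (env γ)) (term t)) (eval t γ) }

  ∃block-definable : ∀ {Q} → Definable blockEnv Q → Definable env (λ γ → ∃ λ x → Q (x , γ))
  ∃block-definable φ = record
    { formula  = ∃ⁿ (m * p) (formula φ)
    ; sound    = λ γ u → let x , v = ∃ⁿ-sound (m * p) (formula φ) u in x , sound φ (x , γ) v
    ; complete = λ γ (x , u) → ∃ⁿ-complete (m * p) (formula φ) x (complete φ (x , γ) u) }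

module _ {ℓ d m n p q : ℕ} {C : Fin m → Fin ℓ → 𝔹} {D : Fin n → Fin ℓ → 𝔹}
         {Col : Fin p → Fin q → Fin (suc ℓ)}
         {rL : Fin p → Fin ℓ → Fin (suc d)} {rR : Fin q → Fin ℓ → Fin (suc d)}
         {Γ : Set} {env : Γ → Vector ℕ k} where

  weigh-affine : ∀ {m p} {X : Γ → Fin m → Fin p → ℕ} → (∀ j z → Affine env (λ γ → X γ j z)) →
                 ∀ g → Affine env (λ γ → weigh (X γ) g)
  weigh-affine {X = X} X-affine g = Σ-affine {H = λ γ j → ΣF (λ z → X γ j z * g z)} (λ j → Σ-affine {H = λ γ z → X γ j z * g z} (λ z → *-affine (X-affine j z) (g z)))

  -- With `Col`, `rL` and `rR` fixed, the unknowns occur only with constant coefficients, so each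
  -- field is a finite Boolean combination of linear conditions.
  solution-definable : {M : Γ → Fin m → ℕ} {N : Γ → Fin n → ℕ}
    {X : Γ → Fin m → Fin p → ℕ} {Y : Γ → Fin n → Fin q → ℕ} →
    (∀ j → Affine env (λ γ → M γ j)) → (∀ j → Affine env (λ γ → N γ j)) →
    (∀ j z → Affine env (λ γ → X γ j z)) → (∀ j z → Affine env (λ γ → Y γ j z)) →
    Definable env (λ γ → Solution C D Col rL rR (M γ) (N γ) (X γ) (Y γ))
  solution-definable {M₀} {N₀} {X₀} {Y₀} M N X Y = map-definable
    (λ γ (c , sL , sR , dL , dR , b , l) → record
      { compatible = c ; sizeL = sL ; sizeR = sR ; demandL = dL ; demandR = dR ; balanced = b ; large = l })
    (λ γ sol → let open Solution sol in compatible , sizeL , sizeR , demandL , demandR , balanced , large)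
    (×-definable (∀-definable λ z → ∀-definable λ w → ∀-definable λ i →
        ⊎-definable (is-zero (const-affine (toℕ (rL z i))))
          (⊎-definable (is-zero (const-affine (toℕ (rR w i)))) (is-zero (const-affine (toℕ (Col z w))))))
    (×-definable (∀-definable λ j → ≡-definable (Σ-affine {H = λ γ → X₀ γ j} (X j)) (M j))
    (×-definable (∀-definable λ k → ≡-definable (Σ-affine {H = λ γ → Y₀ γ k} (Y k)) (N k))
    (×-definable (∀-definable λ j → ∀-definable λ z → ⊎-definable (is-zero (X j z)) (∀-definable λ i →
        ≐-definable (+-affine (weigh-affine {X = Y₀} Y (λ w → δ (Col z w) (suc i))) (const-affine (toℕ (rL z i)))) (C j i)))
    (×-definable (∀-definable λ k → ∀-definable λ w → ⊎-definable (is-zero (Y k w)) (∀-definable λ i →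
        ≐-definable (+-affine (weigh-affine {X = X₀} X (λ z → δ (Col z w) (suc i))) (const-affine (toℕ (rR w i)))) (D k i)))
    (×-definable (∀-definable λ i →
        ≡-definable (weigh-affine {X = X₀} X (λ z → toℕ (rL z i))) (weigh-affine {X = Y₀} Y (λ w → toℕ (rR w i))))
    (∀-definable λ i → ⊎-definable (is-zero (weigh-affine {X = X₀} X (λ z → toℕ (rL z i))))
        (≤-definable (const-affine (threshold ℓ d)) (weigh-affine {X = X₀} X (λ z → toℕ (rL z i)))))))))))
    where
    is-zero : ∀ {h} → Affine env h → Definable env (λ γ → h γ ≡ 0)
    is-zero t = ≡-definable t (const-affine 0)

solvable-definable : {Γ : Set} {env : Γ → Vector ℕ k} {C : Fin m → Fin ℓ → 𝔹} {D : Fin n → Fin ℓ → 𝔹} →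
  ∀ d p q {M : Γ → Fin m → ℕ} {N : Γ → Fin n → ℕ} → (∀ j → Affine env (λ γ → M γ j)) → (∀ j → Affine env (λ γ → N γ j)) →
  Definable env (λ γ → Solvable C D d p q (M γ) (N γ))
solvable-definable {m = m} {ℓ} {n} {env = env} d p q {M₀} {N₀} M N =
  ∃-definable λ κ → ∃-definable λ κL → ∃-definable λ κR →
  ∃block-definable env m P (∃block-definable env₁ n Q (solution-definable
    {M = λ (_ , _ , γ) → M₀ γ} {λ (_ , _ , γ) → N₀ γ} {λ (_ , X , _) → entry X} {λ (Y , _) → entry Y}
    (λ j → weaken-affine env₁ n Q (weaken-affine env m P (M j)))
    (λ k → weaken-affine env₁ n Q (weaken-affine env m P (N k)))
    (λ j z → weaken-affine env₁ n Q (entry-affine env m P j z))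
    (entry-affine env₁ n Q)))
  where
  P = stateCount ℓ d p q
  Q = stateCount ℓ d q p
  env₁ = blockEnv env m P

-- Completions as colourings

-- The summation operator of `V` is part of the type, so that degrees and class sizes given as
-- nested sums transfer to sums over `Fin`.
record Enumeration (V : Set) (sum : (V → ℕ) → ℕ) : Set where
  field
    cardinality : ℕ
    to          : V → Fin cardinality
    from        : Fin cardinality → V
    from-to     : ∀ v → from (to v) ≡ v
    to-from     : ∀ x → to (from x) ≡ x
    sum-from    : ∀ h → ΣF (λ x → h (from x)) ≡ sum h

enumerate-Fin : ∀ a → Enumeration (Fin a) ΣF
enumerate-Fin a = record
  { cardinality = a ; to = id ; from = id ; from-to = λ _ → refl ; to-from = λ _ → refl ; sum-from = λ _ → refl }

enumerate-⊎ : ∀ {V W sum sum′} → Enumeration V sum → Enumeration W sum′ →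
              Enumeration (V ⊎ W) (λ h → sum (h ∘ inj₁) + sum′ (h ∘ inj₂))
enumerate-⊎ {V} {W} {sum} {sum′} E F = record
  { cardinality = E.cardinality + F.cardinality
  ; to = to ; from = from ; from-to = from-to ; to-from = to-from ; sum-from = sum-from }
  where
  module E = Enumeration E
  module F = Enumeration F
  tag : Fin E.cardinality ⊎ Fin F.cardinality → V ⊎ W
  tag (inj₁ x) = inj₁ (E.from x)
  tag (inj₂ y) = inj₂ (F.from y)
  to : V ⊎ W → Fin (E.cardinality + F.cardinality)
  to (inj₁ v) = E.to v ↑ˡ F.cardinality
  to (inj₂ w) = E.cardinality ↑ʳ F.to w
  from : Fin (E.cardinality + F.cardinality) → V ⊎ W
  from x = tag (splitAt E.cardinality x)
  from-↑ˡ : ∀ x → from (x ↑ˡ F.cardinality) ≡ inj₁ (E.from x)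
  from-↑ˡ x = cong tag (splitAt-↑ˡ E.cardinality x F.cardinality)
  from-↑ʳ : ∀ y → from (E.cardinality ↑ʳ y) ≡ inj₂ (F.from y)
  from-↑ʳ y = cong tag (splitAt-↑ʳ E.cardinality F.cardinality y)
  from-to : ∀ v → from (to v) ≡ v
  from-to (inj₁ v) = trans (from-↑ˡ (E.to v)) (cong inj₁ (E.from-to v))
  from-to (inj₂ w) = trans (from-↑ʳ (F.to w)) (cong inj₂ (F.from-to w))
  to-tag : ∀ x → to (tag x) ≡ join E.cardinality F.cardinality x
  to-tag (inj₁ x) = cong (_↑ˡ F.cardinality) (E.to-from x)
  to-tag (inj₂ y) = cong (E.cardinality ↑ʳ_) (F.to-from y)
  to-from : ∀ x → to (from x) ≡ x
  to-from x = trans (to-tag (splitAt E.cardinality x)) (join-splitAt E.cardinality F.cardinality x)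
  sum-from : ∀ h → ΣF (λ x → h (from x)) ≡ sum (h ∘ inj₁) + sum′ (h ∘ inj₂)
  sum-from h = trans (ΣF-split E.cardinality (λ x → h (from x)))
    (cong₂ _+_ (trans (ΣF-cong (λ x → cong h (from-↑ˡ x))) (E.sum-from (h ∘ inj₁)))
               (trans (ΣF-cong (λ y → cong h (from-↑ʳ y))) (F.sum-from (h ∘ inj₂))))

enumerate-Part : (M : Vector ℕ m) → Enumeration (Part M) (λ h → ΣF (λ j → ΣF (λ u → h (j , u))))
enumerate-Part {zero} M = record
  { cardinality = 0 ; to = λ () ; from = λ () ; from-to = λ () ; to-from = λ () ; sum-from = λ _ → refl }
enumerate-Part {suc m} M = record
  { cardinality = E.cardinality
  ; to = λ v → E.to (split v) ; from = λ x → glue (E.from x)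
  ; from-to = λ v → trans (cong glue (E.from-to (split v))) (glue-split v)
  ; to-from = λ x → trans (cong E.to (split-glue (E.from x))) (E.to-from x)
  ; sum-from = λ h → E.sum-from (h ∘ glue) }
  where
  module E = Enumeration (enumerate-⊎ (enumerate-Fin (M zero)) (enumerate-Part (M ∘ suc)))
  split : Part M → Fin (M zero) ⊎ Part (M ∘ suc)
  split (zero , u)  = inj₁ u
  split (suc j , u) = inj₂ (j , u)
  glue : Fin (M zero) ⊎ Part (M ∘ suc) → Part M
  glue (inj₁ u)       = zero , u
  glue (inj₂ (j , u)) = suc j , u
  glue-split : ∀ v → glue (split v) ≡ v
  glue-split (zero , u)  = refl
  glue-split (suc j , u) = refl
  split-glue : ∀ v → split (glue v) ≡ v
  split-glue (inj₁ u)       = refl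
  split-glue (inj₂ (j , u)) = refl

sumSide : (M : Vector ℕ m) (s : ℕ) → (LeftV M s → ℕ) → ℕ
sumSide M s h = ΣF (λ j → ΣF (λ u → h (inj₁ (j , u)))) + ΣF (λ x → h (inj₂ x))

vertices : (M : Vector ℕ m) (s : ℕ) → Enumeration (LeftV M s) (sumSide M s)
vertices M s = enumerate-⊎ (enumerate-Part M) (enumerate-Fin s)

-- Each prescribed vertex forms a class of its own, of size 1.
label : {M : Vector ℕ m} {s : ℕ} → LeftV M s → Fin (m + s)
label {s = s} (inj₁ (j , _)) = j ↑ˡ s
label {m}     (inj₂ x)       = m ↑ʳ x

classSize : ∀ s → Vector ℕ m → Fin (m + s) → ℕ
classSize {m} s M j = [ M , (λ _ → 1) ]′ (splitAt m j)

classDemand : ∀ {s} → (Fin ℓ → Fin m → 𝔹) → (Fin s → Fin ℓ → 𝔹) → Fin (m + s) → Fin ℓ → 𝔹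
classDemand {m = m} C f j i = [ C i , (λ x → f x i) ]′ (splitAt m j)

totalDemand : (Fin k → Fin ℓ → 𝔹) → ℕ
totalDemand β = ΣF (λ j → ΣF (λ i → ⌊ β j i ⌋))

≤totalDemand : (β : Fin k → Fin ℓ → 𝔹) → ∀ j i → ⌊ β j i ⌋ ≤ totalDemand β
≤totalDemand β j i = ≤-trans (term≤ΣF (λ i → ⌊ β j i ⌋) i) (term≤ΣF (λ j → ΣF (λ i → ⌊ β j i ⌋)) j)

side : ∀ {s} (M : Vector ℕ m) (C : Fin ℓ → Fin m → 𝔹) (f : Fin s → Fin ℓ → 𝔹) →
       totalDemand (classDemand C f) ≤ d → Side ℓ d
side {s = s} M C f ≤d = record
  { class = λ x → label (Enumeration.from (vertices M s) x)
  ; demand = classDemand C f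
  ; demand≤d = λ j i → ≤-trans (≤totalDemand (classDemand C f) j i) ≤d }

δ-injective : {φ : Fin k → Fin l} → (∀ {i j} → φ i ≡ φ j → i ≡ j) → ∀ i j → δ (φ i) (φ j) ≡ δ i j
δ-injective {φ = φ} φ-injective i j with i ≟ j
... | yes refl = δ-refl (φ i)
... | no  i≢j  = δ-≢ (i≢j ∘ φ-injective)

↑ˡ≢↑ʳ : ∀ {m s} (i : Fin m) (x : Fin s) → i ↑ˡ s ≢ m ↑ʳ x
↑ˡ≢↑ʳ {m} {s} i x eq
  with () ← trans (sym (splitAt-↑ˡ m i s)) (trans (cong (splitAt m) eq) (splitAt-↑ʳ m s x))

label-count : (M : Vector ℕ m) (s : ℕ) → ∀ j → sumSide M s (λ v → δ (label v) j) ≡ classSize s M j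
label-count {m} M s j with splitAt m j in eq
... | inj₁ j′ with refl ← splitAt⁻¹-↑ˡ {m} {s} eq = begin
  ΣF (λ j → ΣF {M j} (λ _ → δ (j ↑ˡ s) (j′ ↑ˡ s))) + ΣF (λ x → δ (m ↑ʳ x) (j′ ↑ˡ s))
    ≡⟨ cong₂ _+_ (ΣF-cong (λ j → trans (ΣF-const (M j) _) (*-comm (M j) _)))
                 (ΣF-zero {s} (λ x → δ-≢ {i = m ↑ʳ x} (↑ˡ≢↑ʳ j′ x ∘ sym))) ⟩
  ΣF (λ j → δ (j ↑ˡ s) (j′ ↑ˡ s) * M j) + 0
    ≡⟨ +-identityʳ _ ⟩
  ΣF (λ j → δ (j ↑ˡ s) (j′ ↑ˡ s) * M j)
    ≡⟨ ΣF-cong (λ j → cong (_* M j) (δ-injective (↑ˡ-injective s _ _) j j′)) ⟩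
  ΣF (λ j → δ j j′ * M j)
    ≡⟨ ΣF-δ j′ M ⟩
  M j′ ∎
  where open ≡-Reasoning
... | inj₂ x′ with refl ← splitAt⁻¹-↑ʳ {m} {s} eq = cong₂ _+_
  (ΣF-zero (λ j → ΣF-zero {M j} (λ _ → δ-≢ (↑ˡ≢↑ʳ j x′))))
  (trans (ΣF-cong (λ x → trans (δ-injective (↑ʳ-injective m _ _) x x′) (δ-sym x x′))) (ΣF-δ₁ x′))

module _ {ℓ m n : ℕ} (P : PartialBipartite ℓ m n) where
  open PartialBipartite P

  -- A crude common bound for all demands. It depends on `P` alone, and hence so do the bounds on
  -- the cores.
  maxDegree : ℕ
  maxDegree = totalDemand (classDemand C f) + totalDemand (classDemand D g)

  left : Vector ℕ m → Side ℓ maxDegree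
  left M = side M C f (m≤m+n _ _)

  right : Vector ℕ n → Side ℓ maxDegree
  right N = side N D g (m≤n+m _ _)

  module _ (M : Vector ℕ m) (N : Vector ℕ n) where
    private
      module U = Enumeration (vertices M s)
      module V = Enumeration (vertices N t)

    colourOf : (Fin ℓ → Bool) → Fin (suc ℓ)
    colourOf e with any? (λ i → e i ≟ᵇ true)
    ... | yes (i , _) = suc i
    ... | no _        = zero

    -- By disjointness at most one colour is present, so the one that the search finds is the only
    -- one.
    colourOf-δ : ∀ {e : Fin ℓ → Bool} → (∀ i i′ → i ≢ i′ → e i ≡ true → e i′ ≡ true → ⊥) →
                 ∀ i → δ (colourOf e) (suc i) ≡ 𝟙 (e i)
    colourOf-δ {e} disjoint i with any? (λ i → e i ≟ᵇ true)
    ... | no none with e i in eq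
    ...   | true  = contradiction (i , eq) none
    ...   | false = refl
    colourOf-δ {e} disjoint i | yes (i′ , eq) with i′ ≟ i
    ... | yes refl = sym (cong 𝟙 eq)
    ... | no i′≢i with e i in eq′
    ...   | true  = ⊥-elim (disjoint i′ i i′≢i eq eq′)
    ...   | false = refl

    completion⇒feasible : Completion P M N → Feasible (left M) (right N)
    completion⇒feasible G = c , satL , satR
      where
      open Completion G
      c : Graph (left M) (right N)
      c x y = colourOf (λ i → E i (U.from x) (V.from y))
      c-δ : ∀ x y i → δ (c x y) (suc i) ≡ 𝟙 (E i (U.from x) (V.from y))
      c-δ x y = colourOf-δ (λ i i′ i≢i′ → disjoint i i′ i≢i′ (U.from x) (V.from y))
      demandU : ∀ v i → degL i v ≐ classDemand C f (label v) i
      demandU (inj₁ (j , u)) i rewrite splitAt-↑ˡ m j s = degU i j u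
      demandU (inj₂ x)       i rewrite splitAt-↑ʳ m s x = degS i x
      demandV : ∀ v i → degR i v ≐ classDemand D g (label v) i
      demandV (inj₁ (j , v)) i rewrite splitAt-↑ˡ n j t = degV i j v
      demandV (inj₂ y)       i rewrite splitAt-↑ʳ n t y = degT i y
      satL : Satisfies (left M) (right N) c
      satL x i = subst (_≐ required (left M) x i)
        (sym (trans (ΣF-cong (λ y → c-δ x y i)) (V.sum-from (λ v → 𝟙 (E i (U.from x) v)))))
        (demandU (U.from x) i)
      satR : Satisfies (right N) (left M) (flip c)
      satR y i = subst (_≐ required (right N) y i)
        (sym (trans (ΣF-cong (λ x → c-δ x y i)) (U.sum-from (λ u → 𝟙 (E i u (V.from y))))))
        (demandV (V.from y) i)

    feasible⇒completion : Feasible (left M) (right N) → Completion P M N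
    feasible⇒completion (c , satL , satR) = record
      { E = λ i u v → does (c (U.to u) (V.to v) ≟ suc i)
      ; disjoint = λ i i′ i≢i′ u v e e′ → i≢i′ (suc-injective (trans (sym (edge (c (U.to u) (V.to v)) e)) (edge (c (U.to u) (V.to v)) e′)))
      ; degU = λ i j u → subst (degL i (inj₁ (j , u)) ≐_) (cong [ C i , _ ]′ (splitAt-↑ˡ m j s)) (demandU (inj₁ (j , u)) i)
      ; degV = λ i j v → subst (degR i (inj₁ (j , v)) ≐_) (cong [ D i , _ ]′ (splitAt-↑ˡ n j t)) (demandV (inj₁ (j , v)) i)
      ; degS = λ i x → subst (degL i (inj₂ x) ≐_) (cong [ C i , _ ]′ (splitAt-↑ʳ m s x)) (demandU (inj₂ x) i)
      ; degT = λ i y → subst (degR i (inj₂ y) ≐_) (cong [ D i , _ ]′ (splitAt-↑ʳ n t y)) (demandV (inj₂ y) i)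
      }
      where
      edge : ∀ e {i} → does (e ≟ suc i) ≡ true → e ≡ suc i
      edge e {i} _ with e ≟ suc i
      ... | yes eq = eq
      degL : Fin ℓ → LeftV M s → ℕ
      degL i u = sumSide N t (λ v → δ (c (U.to u) (V.to v)) (suc i))
      degR : Fin ℓ → RightV N t → ℕ
      degR i v = sumSide M s (λ u → δ (c (U.to u) (V.to v)) (suc i))
      demandU : ∀ u i → degL i u ≐ classDemand C f (label u) i
      demandU u i = subst₂ _≐_
        (trans (ΣF-cong (λ y → cong (λ y → δ (c (U.to u) y) (suc i)) (sym (V.to-from y))))
               (V.sum-from (λ v → δ (c (U.to u) (V.to v)) (suc i))))
        (cong (λ v → classDemand C f (label v) i) (U.from-to u)) (satL (U.to u) i)
      demandV : ∀ v i → degR i v ≐ classDemand D g (label v) i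
      demandV v i = subst₂ _≐_
        (trans (ΣF-cong (λ x → cong (λ x → δ (c x (V.to v)) (suc i)) (sym (U.to-from x))))
               (U.sum-from (λ u → δ (c (U.to u) (V.to v)) (suc i))))
        (cong (λ v → classDemand D g (label v) i) (V.from-to v)) (satR (V.to v) i)

    sizeL≡population : ∀ j → classSize s M j ≡ population (left M) j
    sizeL≡population j = sym (trans (U.sum-from (λ v → δ (label v) j)) (label-count M s j))

    sizeR≡population : ∀ j → classSize t N j ≡ population (right N) j
    sizeR≡population j = sym (trans (V.sum-from (λ v → δ (label v) j)) (label-count N t j))

  -- The bounds on `p` and `q` do not involve `M` and `N`, so a single finite disjunction covers all
  -- sizes.
  Certified : Vector ℕ m → Vector ℕ n → Set
  Certified M N = ∃ λ p → p ≤ boundL ℓ maxDegree (m + s) (n + t) × ∃ λ q → q ≤ boundR ℓ maxDegree (m + s) (n + t) ×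
    Solvable (classDemand C f) (classDemand D g) maxDegree p q (classSize s M) (classSize t N)

  completion⇒certified : ∀ M N → Completion P M N → Certified M N
  completion⇒certified M N G =
    let p , q , p≤ , q≤ , solvable = feasible⇒solvable (left M) (right N) (completion⇒feasible M N G) in
    p , p≤ , q , q≤ , solvable-cong p q
      (λ j → sym (sizeL≡population M N j)) (λ k → sym (sizeR≡population M N k)) solvable

  certified⇒completion : ∀ M N → Certified M N → Completion P M N
  certified⇒completion M N (p , _ , q , _ , κ , κL , κR , X , Y , sol) = feasible⇒completion M N
    (solution⇒feasible (left M) (right N) (sizeL≡population M N) (sizeR≡population M N) sol)

  sizes : Vector ℕ m × Vector ℕ n → Vector ℕ (m + n)
  sizes (M , N) = M ++ N

  certified-definable : Definable sizes (λ (M , N) → Certified M N)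
  certified-definable =
    ∃≤-definable _ λ p → ∃≤-definable _ λ q → 
      solvable-definable maxDegree p q
        {λ (M , _) → classSize s M} {λ (_ , N) → classSize t N} sizeL-affine sizeR-affine
    where
    sizeL-affine : ∀ j → Affine sizes (λ (M , _) → classSize s M j)
    sizeL-affine j with splitAt m j
    ... | inj₁ j′ = record { term = var (j′ ↑ˡ n) ; eval = λ (M , N) → lookup-++ˡ M N j′ }
    ... | inj₂ _  = const-affine 1
    sizeR-affine : ∀ k → Affine sizes (λ (_ , N) → classSize t N k)
    sizeR-affine k with splitAt n k
    ... | inj₁ k′ = record { term = var (m ↑ʳ k′) ; eval = λ (M , N) → lookup-++ʳ M N k′ }
    ... | inj₂ _  = const-affine 1

theorem10 : ∀ {ℓ m n : ℕ} (P : PartialBipartite ℓ m n) →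
    Σ (Formula (m + n)) λ Ψ →
    ∀ (M : Vector ℕ m) (N : Vector ℕ n) →
    BigEnough (PartialBipartite.C P) (PartialBipartite.D P) M N →
    (Completion P M N ⇔ holds Ψ M N)
theorem10 P = formula Ψ , λ M N _ → mk⇔
  (λ G → complete Ψ (M , N) (completion⇒certified P M N G))
  (λ h → certified⇒completion P M N (sound Ψ (M , N) h))
  where Ψ = certified-definable P
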